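{- Let $u$ be a packed word of length $n$. Then $$V_u(t):=\mathbf{N}_u*(\sigma_1^t)_n=\sum_{k=1}^n t^k\,\mathbf{N}_u*E_n^{[k]}=\sum_{w\ge u}\ \prod_{i=1}^{\max(u)}\binom{t}{\max(w^{(i)})}\ \mathbf{N}_w,$$ where the sum is over packed words $w$ of length $n$ finer than $u$, and $w^{(i)}=\mathrm{pack}(w_{j_1}w_{j_2}\cdots w_{j_p})$ with $\{j_1<\dots<j_p\}=\{j: u_j=i\}$.
   Context: $\mathbb{K}$ is a field of characteristic $0$, $t$ an indeterminate. A word over the positive integers is packed if its set of letters is $\{1,\dots,r\}$ for some $r$; then $r=\max(u)$. For a word $w$ over a totally ordered alphabet with distinct letters $b_1<\dots<b_r$, $\mathrm{pack}(w)$ is obtained by replacing each $b_i$ by $i$. A packed word $u=u_1\cdots u_n$ is identified with the set composition of $\{1,\dots,n\}$ whose $i$-th block is $\{j:u_j=i\}$. For packed words $u,w$ of length $n$, $w$ is finer than $u$, written $w\ge u$, if the set composition $u$ is obtained from $w$ by merging some consecutive blocks (equivalently $w_i\le w_j\Rightarrow u_i\le u_j$ for all $i,j$). $\mathbf{WQSym}^*_n$ is the $\mathbb{K}$-vector space with basis $\mathbf{N}_u$, $u$ running over packed words of length $n$, with internal product $\mathbf{N}_u*\mathbf{N}_v=\mathbf{N}_{\mathrm{pack}\binom{u}{v}}$, where $\binom{u}{v}$ is the word of biletters $\binom{u_1}{v_1}\cdots\binom{u_n}{v_n}$, ordered lexicographically with priority to the top letter; scalars are extended to $\mathbb{K}[t]$.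 The degree $n$ component of $\sigma_1^t$ is $$(\sigma_1^t)_n=\sum_{|u|=n}\binom{t}{\max(u)}\mathbf{N}_u=\sum_{k=1}^n t^kE_n^{[k]},$$ the first sum being over all packed words of length $n$; the second equality defines the Eulerian idempotents $E_n^{[k]}$. -}

module Defs where

open import Level using (Level; _⊔_)
open import Algebra.Apartness.Bundles using (HeytingField; HeytingCommutativeRing)
open import Algebra.Bundles using (CommutativeRing)
open import Algebra.Bundles.Raw using (RawRing)
import Algebra.Definitions.RawMonoid as RawMonoidDefinitions
open import Data.List.Base as List
  using (List; []; _∷_; length; filter; deduplicate; upTo; mapMaybe; cartesianProductWith)
import Data.List.Membership.Propositional as ListMembership
import Data.List.Membership.Propositional.Properties as ListMembershipₚ
import Data.List.Membership.Setoid.Properties as SetoidMembershipₚ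
import Data.List.Properties as Listₚ
open import Data.List.Relation.Binary.Permutation.Propositional using (↭-sym)
open import Data.List.Relation.Binary.Permutation.Propositional.Properties
  using (↭-length; filter-↭; ∈-resp-↭)
import Data.List.Relation.Binary.Permutation.Setoid.Properties as Permutationₛₚ
import Data.List.Relation.Unary.All as ListAll
import Data.List.Relation.Unary.All.Properties as ListAllₚ
open import Data.List.Relation.Unary.AllPairs as AllPairs using (AllPairs; []; _∷_)
import Data.List.Relation.Unary.Any as ListAny
open import Data.List.Relation.Unary.Sorted.TotalOrder.Properties using (Sorted⇒AllPairs)
import Data.List.Relation.Unary.Unique.DecSetoid.Properties as Uniqueₚ
import Data.List.Sort as Sort
open import Data.Fin.Base using (Fin)
import Data.Fin.Properties as Finₚ
open import Data.Maybe.Base using (Maybe; just; nothing)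
open import Data.Nat.Base as ℕ using (ℕ; zero; suc; NonZero; z≤n; s≤s; _!)
open import Data.Nat.Properties as ℕₚ using (_!≢0)
open import Data.Product.Base using (_×_; _,_; proj₁; proj₂; ∃)
open import Data.Product.Relation.Binary.Lex.NonStrict using (×-decTotalOrder)
open import Data.Vec.Base as Vec using (Vec; []; _∷_; lookup; toList; fromList)
import Data.Vec.Membership.DecPropositional as DecVecMembership
open import Data.Vec.Membership.Propositional using (_∈_)
import Data.Vec.Membership.Propositional.Properties as VecMembershipₚ
import Data.Vec.Properties as Vecₚ
open import Data.Vec.Relation.Unary.Any using (here; there)
open import Function.Base using (_∘_)
open import Function.Bundles using (_⇔_; mk⇔; Equivalence)
open import Relation.Binary.Bundles using (DecTotalOrder)
open import Relation.Binary.Definitions using (DecidableEquality)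
open import Relation.Binary.PropositionalEquality
  using (_≡_; refl; sym; trans; cong; subst)
open import Relation.Nullary.Negation.Core using (¬_)
open import Relation.Nullary.Decidable.Core
  using (Dec; yes; no; map′; _×-dec_; _→-dec_; recompute)

private variable
  a ℓ ℓ₁ ℓ₂ : Level
  A : Set a
  n : ℕ

range : ℕ → List ℕ
range n = List.map suc (upTo n)

∈-range⁺ : ∀ {i r} → 1 ℕ.≤ i → i ℕ.≤ r → i ListMembership.∈ range r
∈-range⁺ (s≤s z≤n) i≤r = ListMembershipₚ.∈-map⁺ suc (ListMembershipₚ.∈-upTo⁺ i≤r)

∈-range⁻ : ∀ {i r} → i ListMembership.∈ range r → 1 ℕ.≤ i × i ℕ.≤ r
∈-range⁻ i∈ with ListMembershipₚ.∈-map⁻ suc i∈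
... | j , j∈ , refl = s≤s z≤n , ListMembershipₚ.∈-upTo⁻ j∈

maxLetter : Vec ℕ n → ℕ
maxLetter = Vec.foldr _ ℕ._⊔_ 0

∈⇒≤maxLetter : ∀ {i} {w : Vec ℕ n} → i ∈ w → i ℕ.≤ maxLetter w
∈⇒≤maxLetter {w = x ∷ w} (here refl) = ℕₚ.m≤m⊔n x (maxLetter w)
∈⇒≤maxLetter {w = x ∷ w} (there i∈)  = ℕₚ.≤-trans (∈⇒≤maxLetter i∈) (ℕₚ.m≤n⊔m x (maxLetter w))

maxLetter≤ : ∀ {r} (w : Vec ℕ n) → (∀ {i} → i ∈ w → i ℕ.≤ r) → maxLetter w ℕ.≤ r
maxLetter≤ []      h = z≤n
maxLetter≤ (x ∷ w) h = ℕₚ.⊔-lub (h (here refl)) (maxLetter≤ w (h ∘ there))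

∈-mapVec⁻ : ∀ {B : Set ℓ} (f : A → B) {y} {w : Vec A n} →
            y ∈ Vec.map f w → ∃ λ x → x ∈ w × y ≡ f x
∈-mapVec⁻ f {w = x ∷ w} (here y≡)  = x , here refl , y≡
∈-mapVec⁻ f {w = x ∷ w} (there y∈) with z , z∈ , y≡ ← ∈-mapVec⁻ f y∈ = z , there z∈ , y≡

IsPacked : Vec ℕ n → Set
IsPacked w = ∃ λ r → ∀ i → i ∈ w ⇔ (1 ℕ.≤ i × i ℕ.≤ r)

isPacked? : (w : Vec ℕ n) → Dec (IsPacked w)
isPacked? w = map′ to from
  (ListAll.all? (1 ℕₚ.≤?_) (toList w) ×-dec ListAll.all? (_∈? w) (range (maxLetter w)))
  where
  open DecVecMembership ℕₚ._≟_ using (_∈?_)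
  to : ListAll.All (1 ℕ.≤_) (toList w) × ListAll.All (_∈ w) (range (maxLetter w)) → IsPacked w
  to (pos , surj) = maxLetter w , λ i → mk⇔
    (λ i∈ → ListAll.lookup pos (VecMembershipₚ.∈-toList⁺ i∈) , ∈⇒≤maxLetter i∈)
    (λ (1≤i , i≤r) → ListAll.lookup surj (∈-range⁺ 1≤i i≤r))
  from : IsPacked w → ListAll.All (1 ℕ.≤_) (toList w) × ListAll.All (_∈ w) (range (maxLetter w))
  from (r , h) =
      ListAll.tabulate (λ i∈ → proj₁ (Equivalence.to (h _) (VecMembershipₚ.∈-toList⁻ i∈)))
    , ListAll.tabulate (λ i∈ → let 1≤i , i≤max = ∈-range⁻ i∈ in
        Equivalence.from (h _) (1≤i , ℕₚ.≤-trans i≤max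
          (maxLetter≤ w (λ j∈ → proj₂ (Equivalence.to (h _) j∈)))))

-- The proof of packedness is irrelevant, so packed words are
-- propositionally equal as soon as their underlying words are.
record PackedWord (n : ℕ) : Set where
  constructor packedWord
  field
    word      : Vec ℕ n
    .isPacked : IsPacked word

open PackedWord public using (word)

isPacked : (u : PackedWord n) → IsPacked (word u)
isPacked (packedWord w p) = recompute (isPacked? w) p

_≟ᴾ_ : DecidableEquality (PackedWord n)
packedWord v _ ≟ᴾ packedWord w _ =
  map′ (λ { refl → refl }) (cong word) (Vecₚ.≡-dec ℕₚ._≟_ v w)

max : PackedWord n → ℕ
max u = maxLetter (word u)

wordsOver : List A → (n : ℕ) → List (Vec A n)
wordsOver as zero    = [] ∷ []
wordsOver as (suc n) = cartesianProductWith _∷_ as (wordsOver as n)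

-- All packed words of length n, each exactly once: a word of length n has at
-- most n distinct letters, so its letters lie in {1,…,n} if it is packed.
packedWords : (n : ℕ) → List (PackedWord n)
packedWords n = mapMaybe toPackedWord (wordsOver (range n) n)
  where
  toPackedWord : Vec ℕ n → Maybe (PackedWord n)
  toPackedWord w with isPacked? w
  ... | yes p = just (packedWord w p)
  ... | no  _ = nothing

module Packing (O : DecTotalOrder a ℓ₁ ℓ₂) where
  open DecTotalOrder O
    renaming (Carrier to Letter; refl to ≤-refl; trans to ≤-trans)

  letters : Vec Letter n → List Letter
  letters w = deduplicate _≟_ (toList w)

  -- If b₁ < … < bᵣ are the distinct letters of w, then rank w bᵢ is i: it is
  -- the number of distinct letters of w which are at most bᵢ.
  rank : Vec Letter n → Letter → ℕ
  rank w b = length (filter (_≤? b) (letters w))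

  packVec : Vec Letter n → Vec ℕ n
  packVec w = Vec.map (rank w) w

  rank≥1 : (w : Vec Letter n) → ∀ {b} → b ∈ w → 1 ℕ.≤ rank w b
  rank≥1 w {b} b∈ = Listₚ.filter-some (_≤? b) (ListAny.map (reflexive ∘ Eq.sym)
    (SetoidMembershipₚ.∈-deduplicate⁺ Eq.setoid _≟_ (λ c≈d e≈c → Eq.trans e≈c (Eq.sym c≈d))
      (ListAny.map Eq.reflexive (VecMembershipₚ.∈-toList⁺ b∈))))

  private
    _<_ : Letter → Letter → Set _
    b < c = b ≤ c × ¬ b ≈ c

    <⇒≱ : ∀ {b c} → b < c → ¬ c ≤ b
    <⇒≱ (b≤c , b≉c) c≤b = b≉c (antisym b≤c c≤b)

    hitAscending : ∀ {bs} → AllPairs _<_ bs → ∀ {k} → 1 ℕ.≤ k → k ℕ.≤ length bs →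
                   ∃ λ b → b ListMembership.∈ bs × length (filter (_≤? b) bs) ≡ k
    hitAscending {b ∷ bs} (b<bs ∷ _) {suc zero} _ _ =
      b , ListAny.here refl ,
      trans (cong length (Listₚ.filter-accept (_≤? b) ≤-refl))
            (cong (suc ∘ length) (Listₚ.filter-none (_≤? b) (ListAll.map <⇒≱ b<bs)))
    hitAscending {b ∷ bs} (b<bs ∷ asc) {suc (suc k)} _ (s≤s k≤)
      with c , c∈ , eq ← hitAscending asc (s≤s z≤n) k≤ =
      c , ListAny.there c∈ ,
      trans (cong length (Listₚ.filter-accept (_≤? c) (proj₁ (ListAll.lookup b<bs c∈))))
            (cong suc eq)

  rank-surjective : (w : Vec Letter n) → ∀ {k} → 1 ℕ.≤ k → k ℕ.≤ length (letters w) →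
                    ∃ λ b → b ∈ w × rank w b ≡ k
  rank-surjective w {k} 1≤k k≤ =
    let open Sort O
        ls  = letters w
        asc = AllPairs.zip (Sorted⇒AllPairs totalOrder (sort-↗ ls) ,
                Permutationₛₚ.Unique-resp-↭ Eq.setoid
                  (SP.↭-sym (Sorting.sort-↭ₛ ls))
                  (Uniqueₚ.deduplicate-! decSetoid (toList w)))
        b , b∈ , eq = hitAscending asc 1≤k
                        (subst (k ℕ.≤_) (sym (↭-length (sort-↭ ls))) k≤)
    in b ,
       VecMembershipₚ.∈-toList⁻
         (ListMembershipₚ.∈-deduplicate⁻ _≟_ (toList w) (∈-resp-↭ (sort-↭ ls) b∈)) ,
       trans (↭-length (filter-↭ (_≤? b) (↭-sym (sort-↭ ls)))) eq
    where
    import Data.List.Relation.Binary.Permutation.Setoid Eq.setoid as SP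
    open import Data.List.Sort.Base totalOrder using (module SortingAlgorithm)
    module Sorting = SortingAlgorithm (Sort.sortingAlgorithm O)
    decSetoid = Eq.decSetoid

  packVec-isPacked : (w : Vec Letter n) → IsPacked (packVec w)
  packVec-isPacked w = length (letters w) , λ i → mk⇔ to from
    where
    to : ∀ {i} → i ∈ packVec w → 1 ℕ.≤ i × i ℕ.≤ length (letters w)
    to i∈ with ∈-mapVec⁻ (rank w) i∈
    ... | b , b∈ , refl = rank≥1 w b∈ , Listₚ.length-filter (_≤? b) (letters w)
    from : ∀ {i} → 1 ℕ.≤ i × i ℕ.≤ length (letters w) → i ∈ packVec w
    from (1≤i , i≤) with rank-surjective w 1≤i i≤
    ... | b , b∈ , refl = VecMembershipₚ.∈-map⁺ (rank w) b∈

  pack : Vec Letter n → PackedWord n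
  pack w = packedWord (packVec w) (packVec-isPacked w)

open Packing ℕₚ.≤-decTotalOrder public using () renaming (pack to packℕ)
open Packing (×-decTotalOrder ℕₚ.≤-decTotalOrder ℕₚ.≤-decTotalOrder) public
  using () renaming (pack to packBiword)

_finerThan_ : PackedWord n → PackedWord n → Set
_finerThan_ {n} w u = (i j : Fin n) →
  lookup (word w) i ℕ.≤ lookup (word w) j → lookup (word u) i ℕ.≤ lookup (word u) j

_finerThan?_ : (w u : PackedWord n) → Dec (w finerThan u)
w finerThan? u = Finₚ.all? λ i → Finₚ.all? λ j →
  (lookup (word w) i ℕₚ.≤? lookup (word w) j) →-dec (lookup (word u) i ℕₚ.≤? lookup (word u) j)

finerWords : PackedWord n → List (PackedWord n)
finerWords {n} u = filter (_finerThan? u) (packedWords n)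

-- The subword w_{j₁}⋯w_{jₚ} of w, where {j₁ < … < jₚ} = {j : u_j = i}.
subwordAt : (u w : PackedWord n) → ℕ → List ℕ
subwordAt u w i =
  List.map proj₂ (filter (λ (uⱼ , _) → uⱼ ℕₚ.≟ i) (toList (Vec.zip (word u) (word w))))

-- w⁽ⁱ⁾, relative to u
block : (u w : PackedWord n) (i : ℕ) → PackedWord (length (subwordAt u w i))
block u w i = packℕ (fromList (subwordAt u w i))

module Polynomial (R : RawRing a ℓ) where
  open RawRing R

  -- Coefficient lists, constant term first; trailing zeros are allowed, so
  -- equality has to be equality of all coefficients.
  Poly : Set a
  Poly = List Carrier

  coeff : Poly → ℕ → Carrier
  coeff []      k       = 0#
  coeff (a ∷ p) zero    = a
  coeff (a ∷ p) (suc k) = coeff p k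

  constant : Carrier → Poly
  constant a = a ∷ []

  t : Poly
  t = 0# ∷ 1# ∷ []

  _+ᴾ_ : Poly → Poly → Poly
  []      +ᴾ q       = q
  (a ∷ p) +ᴾ []      = a ∷ p
  (a ∷ p) +ᴾ (b ∷ q) = (a + b) ∷ (p +ᴾ q)

  _*ᴾ_ : Poly → Poly → Poly
  []      *ᴾ q = []
  (a ∷ p) *ᴾ q = List.map (a *_) q +ᴾ (0# ∷ (p *ᴾ q))

  rawRing[t] : RawRing a ℓ
  rawRing[t] = record
    { Carrier = Poly
    ; _≈_     = λ p q → ∀ k → coeff p k ≈ coeff q k
    ; _+_     = _+ᴾ_
    ; _*_     = _*ᴾ_
    ; -_      = List.map (-_)
    ; 0#      = []
    ; 1#      = constant 1#
    }

module WQSym* (R : RawRing a ℓ) where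
  open RawRing R

  power : Carrier → ℕ → Carrier
  power x zero    = 1#
  power x (suc k) = x * power x k

  product : List A → (A → Carrier) → Carrier
  product xs f = List.foldr (λ x p → f x * p) 1# xs

  -- Since the basis is finite, an element is its family of coefficients.
  WQSym : ℕ → Set a
  WQSym n = PackedWord n → Carrier

  infix 4 _≋_
  infixr 7 _•_
  infixl 6 _⊕_
  infixl 7 _∗_

  _≋_ : WQSym n → WQSym n → Set ℓ
  f ≋ g = ∀ u → f u ≈ g u

  𝟘 : WQSym n
  𝟘 _ = 0#

  _⊕_ : WQSym n → WQSym n → WQSym n
  (f ⊕ g) u = f u + g u

  _•_ : Carrier → WQSym n → WQSym n
  (a • f) u = a * f u

  ∑ : List A → (A → WQSym n) → WQSym n
  ∑ xs f = List.foldr (λ x s → f x ⊕ s) 𝟘 xs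

  N : PackedWord n → WQSym n
  N u v with u ≟ᴾ v
  ... | yes _ = 1#
  ... | no  _ = 0#

  -- The bilinear extension of N u ∗ N v = N (pack of the biword u over v).
  _∗_ : WQSym n → WQSym n → WQSym n
  _∗_ {n} f g = ∑ (packedWords n) λ u → ∑ (packedWords n) λ v →
    (f u * g v) • N (packBiword (Vec.zip (word u) (word v)))

rawRingOf : ∀ {c ℓ₁ ℓ₂} → HeytingField c ℓ₁ ℓ₂ → RawRing c ℓ₁
rawRingOf K = CommutativeRing.rawRing
  (HeytingCommutativeRing.commutativeRing (HeytingField.heytingCommutativeRing K))

-- For a discrete field (with _#_ the negation of _≈_) this is the usual
-- condition; in general _#_ is the form of "nonzero" that gives invertibility.
CharacteristicZero : ∀ {c ℓ₁ ℓ₂} → HeytingField c ℓ₁ ℓ₂ → Set ℓ₂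
CharacteristicZero K = ∀ n → .{{NonZero n}} → (n ×ᴷ 1#) # 0#
  where
  open HeytingField K using (_#_; 0#; 1#)
  open RawMonoidDefinitions (RawRing.+-rawMonoid (rawRingOf K)) using () renaming (_×_ to _×ᴷ_)

module Eulerian {c ℓ₁ ℓ₂} (K : HeytingField c ℓ₁ ℓ₂) (char0 : CharacteristicZero K) where
  open HeytingField K using (1#; #⇒invertible) renaming (Carrier to ∣K∣)

  rawK : RawRing c ℓ₁
  rawK = rawRingOf K

  open RawMonoidDefinitions (RawRing.+-rawMonoid rawK) using () renaming (_×_ to _×ᴷ_)

  open Polynomial rawK public using (Poly; coeff; constant; t; rawRing[t])
  module K[t] = RawRing rawRing[t]

  module Over-K    = WQSym* rawK
  module Over-K[t] = WQSym* rawRing[t]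

  1/_ : (n : ℕ) → .{{NonZero n}} → ∣K∣
  1/ n = proj₁ (#⇒invertible (char0 n))

  -- t (t - 1) ⋯ (t - m + 1)
  fallingFactorial : ℕ → Poly
  fallingFactorial zero    = K[t].1#
  fallingFactorial (suc m) = fallingFactorial m K[t].* (t K[t].+ K[t].- constant (m ×ᴷ 1#))

  binomial : ℕ → Poly
  binomial m = constant ((1/ (m !)) {{m !≢0}}) K[t].* fallingFactorial m

  extendScalars : Over-K.WQSym n → Over-K[t].WQSym n
  extendScalars f u = constant (f u)

  σᵗ : (n : ℕ) → Over-K[t].WQSym n
  σᵗ n = ∑ (packedWords n) λ u → binomial (max u) • N u
    where open Over-K[t]

  -- For n ≥ 1 these are the elements over K defined by the expansion
  -- σᵗ n = Σ_{k=1}^{n} tᵏ E n k.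
  E : (n k : ℕ) → Over-K.WQSym n
  E n k u = coeff (σᵗ n u) k

module Submission where

-- Both sides of the second identity are polynomials in t, so over a field of characteristic 0
-- it is enough to compare their values at all natural numbers q. At t = q, binom(t, max v) counts the
-- words x of length n over an alphabet of q letters with pack(x) = v, so that σ_1^q is the sum of
-- N_{pack(x)} over all words x, and the coefficient of N_w in N_u * σ_1^q is the number of words x
-- with pack(u over x) = w. This condition can hold only if w is finer than u; it then says that for
-- each i the subword of x at the positions of the letter i of u packs to w^(i). These subwords can be
-- chosen independently of each other, whence the product of binomial coefficients.

open import Defs
open import Algebra.Apartness.Bundles using (HeytingField; HeytingCommutativeRing)
open import Algebra.Bundles using (CommutativeRing)
open import Algebra.Bundles.Raw using (RawRing)
import Algebra.Properties.AbelianGroup as AbelianGroupProperties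
import Algebra.Properties.Group as GroupProperties
import Algebra.Properties.Ring as RingProperties
import Algebra.Properties.Semiring.Mult as SemiringMult
import Algebra.Solver.Ring.NaturalCoefficients.Default as Solver
open import Data.Bool.Base using (true)
open import Data.Fin.Base as Fin using (Fin; zero; suc)
import Data.Fin.Properties as Finₚ
open import Data.List.Base as List
  using (List; []; _∷_; _++_; length; filter; map; upTo; cartesianProductWith; mapMaybe; foldr)
import Data.List.Membership.Propositional as L
import Data.List.Membership.Propositional.Properties as ∈ₚ
open import Data.List.Membership.Propositional.Properties.WithK using (unique∧set⇒bag)
import Data.List.Membership.Setoid.Properties as SetoidMembershipₚ
import Data.List.Properties as Listₚ
open import Data.List.Relation.Binary.BagAndSetEquality using (∼bag⇒↭)
open import Data.List.Relation.Binary.Permutation.Propositional.Properties using (↭-length)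
open import Data.List.Relation.Unary.All as All using (All; []; _∷_)
open import Data.List.Relation.Unary.AllPairs using ([]; _∷_)
open import Data.List.Relation.Unary.Any as Any using (Any; here; there)
open import Data.List.Relation.Unary.Unique.Propositional using (Unique)
import Data.List.Relation.Unary.Unique.Propositional.Properties as Uniqueₚ
open import Data.Maybe.Base using (Maybe; just; nothing)
open import Data.Nat.Base
  using (ℕ; zero; suc; _+_; _*_; _∸_; _≤_; _<_; _≤ᵇ_; z≤n; s≤s; NonZero; _!)
open import Data.Nat.Combinatorics
  using (_C_; nCn≡1; nCk≡nC[n∸k]; nCk≡nPk/k!; k>n⇒nCk≡0; nCk+nC[k+1]≡[n+1]C[k+1])
open import Data.Nat.Combinatorics.Base using (_P_; _P′_)
open import Data.Nat.Combinatorics.Specification using (k!∣nP′k)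
open import Data.Nat.Divisibility using (_∣_)
open import Data.Nat.DivMod using (_/_; m/n*n≡m)
import Data.Nat.Properties as ℕₚ
open ℕₚ using (_!≢0)
open import Data.Nat.Tactic.RingSolver using (solve-∀)
open import Data.Product.Base using (_×_; _,_; proj₁; proj₂; ∃)
open import Data.Product.Relation.Binary.Lex.NonStrict using (×-decTotalOrder)
open import Data.Sum.Base using (_⊎_; inj₁; inj₂)
open import Data.Vec.Base as Vec using (Vec; []; _∷_; lookup; toList)
open import Data.Vec.Membership.Propositional using (_∈_)
import Data.Vec.Membership.Propositional.Properties as VecMembershipₚ
import Data.Vec.Properties as Vecₚ
open import Data.Vec.Relation.Binary.Pointwise.Extensional using (ext; Pointwise-≡⇒≡)
import Data.Vec.Relation.Unary.Any as VecAny
import Data.Vec.Relation.Unary.Any.Properties as VecAnyₚ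
open import Function.Base using (_∘_)
open import Function.Bundles using (_⇔_; mk⇔; Equivalence)
import Function.Properties.Equivalence as ⇔
open import Level using (Level; 0ℓ)
open import Relation.Binary.Bundles using (DecTotalOrder)
open import Relation.Binary.Definitions using (tri<; tri≈; tri>)
open import Relation.Binary.PropositionalEquality
  using (_≡_; _≢_; refl; sym; trans; cong; cong₂; subst; subst₂; module ≡-Reasoning)
import Relation.Binary.Reasoning.Setoid as SetoidReasoning
open import Relation.Nullary.Decidable.Core using (Dec; yes; no; _×-dec_; _→-dec_)
open import Relation.Nullary.Negation.Core using (¬_; contradiction)
open import Relation.Unary using (Pred; Decidable)

open Equivalence using (to; from)

-- Equality in K is not assumed decidable, so roots are not counted against the degree in the usual
-- way: a natural root is divided out, and the difference between it and any later natural number is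
-- cancelled because it is invertible in characteristic 0. The counting takes place in a copy of
-- `WQSym*` with coefficients in ℕ; the relation "this polynomial takes this natural value at q"
-- carries the result back to K[t]. Packing is handled through order alone. A packed word is
-- determined by the comparisons between its positions, so pack(x) = v says only that x and v
-- compare all positions alike. One criterion then serves words, biwords and subwords, and no
-- explicit relabelling of letters has to be followed through the biword. The first identity is not
-- obtained by evaluation. Since `E n k` is the coefficient of t^k in `σᵗ n`, and multiplication by
-- `N u` acts coefficientwise, the only point left is that the coefficients of t^0 and of t^k for k
-- > n vanish. The former is where n ≥ 1 enters: for n = 0 the component is the constant 1.

private variable
  ℓᵃ ℓᵇ ℓᶜ : Level
  A : Set ℓᵃ
  B : Set ℓᵇ
  C′ : Set ℓᶜ
  n : ℕ

-- Packed words

module _ {a p q} {A : Set a} {P : Pred A p} {Q : Pred A q} (P? : Decidable P) (Q? : Decidable Q)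
         (P⊆Q : ∀ {x} → P x → Q x) where

  length-filter-mono : ∀ xs → length (filter P? xs) ≤ length (filter Q? xs)
  length-filter-mono [] = z≤n
  length-filter-mono (x ∷ xs) with P? x | Q? x
  ... | yes _ | yes _ = s≤s (length-filter-mono xs)
  ... | yes p | no ¬q = contradiction (P⊆Q p) ¬q
  ... | no  _ | yes _ = ℕₚ.m≤n⇒m≤1+n (length-filter-mono xs)
  ... | no  _ | no  _ = length-filter-mono xs

  length-filter-strictMono : ∀ {xs} → Any (λ x → Q x × ¬ P x) xs →
                             length (filter P? xs) < length (filter Q? xs)
  length-filter-strictMono {x ∷ xs} x∈ with P? x | Q? x | x∈
  ... | yes p | _     | here (_ , ¬p) = contradiction p ¬p
  ... | no  _ | no ¬q | here (q , _)  = contradiction q ¬q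
  ... | no  _ | yes _ | here _        = s≤s (length-filter-mono xs)
  ... | yes _ | yes _ | there x∈xs    = s≤s (length-filter-strictMono x∈xs)
  ... | yes p | no ¬q | there _       = contradiction (P⊆Q p) ¬q
  ... | no  _ | yes _ | there x∈xs    = ℕₚ.m≤n⇒m≤1+n (length-filter-strictMono x∈xs)
  ... | no  _ | no  _ | there x∈xs    = length-filter-strictMono x∈xs

word-injective : {u v : PackedWord n} → word u ≡ word v → u ≡ v
word-injective {u = packedWord _ _} {packedWord _ _} refl = refl

lookup-extensional : ∀ {a} {A : Set a} {v w : Vec A n} → (∀ i → lookup v i ≡ lookup w i) → v ≡ w
lookup-extensional eq = Pointwise-≡⇒≡ (ext eq)

∈⇒lookup : ∀ {a} {A : Set a} {x} {w : Vec A n} → x ∈ w → ∃ λ i → lookup w i ≡ x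
∈⇒lookup x∈ = VecAny.index x∈ , sym (VecAnyₚ.lookup-index x∈)

-- In a packed word, the letter k + 1 is accompanied by the letter k unless k = 0;
-- hence letters can be compared by induction on their value.
packed-letter-≤ : (u v : PackedWord n) →
  (∀ i j → lookup (word v) i ≤ lookup (word v) j → lookup (word u) i ≤ lookup (word u) j) →
  ∀ i → lookup (word u) i ≤ lookup (word v) i
packed-letter-≤ u v v⇒u i = ≤-at (lookup (word u) i) i refl
  where
  ≤-at : ∀ k i → lookup (word u) i ≡ k → k ≤ lookup (word v) i
  ≤-at zero          i eq = z≤n
  ≤-at (suc zero)    i eq = proj₁ (to (proj₂ (isPacked v) _) (VecMembershipₚ.∈-lookup i (word v)))
  ≤-at (suc (suc k)) i eq =
    let r , h      = isPacked u
        _ , 2+k≤r  = to (h (suc (suc k))) (subst (_∈ word u) eq (VecMembershipₚ.∈-lookup i (word u)))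
        j , uⱼ≡1+k = ∈⇒lookup (from (h (suc k)) (s≤s z≤n , ℕₚ.≤-trans (ℕₚ.n≤1+n _) 2+k≤r))
        vⱼ<vᵢ      = ℕₚ.≰⇒> λ vᵢ≤vⱼ →
          ℕₚ.1+n≰n (subst₂ _≤_ eq uⱼ≡1+k (v⇒u i j vᵢ≤vⱼ))
    in ℕₚ.≤-<-trans (≤-at (suc k) j uⱼ≡1+k) vⱼ<vᵢ

-- Each direction of the equivalence bounds the letters of one word by those of the other;
-- antisymmetry concludes.
packed-≡ : (u v : PackedWord n) →
  (∀ i j → lookup (word u) i ≤ lookup (word u) j ⇔ lookup (word v) i ≤ lookup (word v) j) → u ≡ v
packed-≡ u v h = word-injective (lookup-extensional λ i → ℕₚ.≤-antisym
  (packed-letter-≤ u v (λ i j → from (h i j)) i)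
  (packed-letter-≤ v u (λ i j → to (h i j)) i))

-- Packing characterized by the comparison of positions

module PackingProperties {a ℓ₁ ℓ₂} (O : DecTotalOrder a ℓ₁ ℓ₂) where
  open DecTotalOrder O
    renaming (Carrier to Letter; _≤_ to _≼_; _≤?_ to _≼?_; trans to ≼-trans; total to ≼-total)
  open Packing O

  rank-mono : (w : Vec Letter n) → ∀ {b c} → b ≼ c → rank w b ≤ rank w c
  rank-mono w b≼c = length-filter-mono (_≼? _) (_≼? _) (λ d≼b → ≼-trans d≼b b≼c) (letters w)

  -- By contraposition: if b ⋠ c, then c ≼ b by totality, and b itself is one of the distinct
  -- letters counted in `rank w b` but not in `rank w c`, so the ranks differ strictly. This is
  -- where b must occur in w.
  rank-cancel : (w : Vec Letter n) → ∀ {b c} → b ∈ w → rank w b ≤ rank w c → b ≼ c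
  rank-cancel w {b} {c} b∈ r≤ with b ≼? c
  ... | yes b≼c = b≼c
  ... | no  b⋠c = contradiction r≤ (ℕₚ.<⇒≱ (length-filter-strictMono (_≼? c) (_≼? b)
                    (λ d≼c → ≼-trans d≼c c≼b)
                    (Any.map (λ b≈d → reflexive (Eq.sym b≈d) , λ d≼c → b⋠c (≼-trans (reflexive b≈d) d≼c))
                      b∈letters)))
    where
    c≼b : c ≼ b
    c≼b with ≼-total b c
    ... | inj₁ b≼c = contradiction b≼c b⋠c
    ... | inj₂ c≼b = c≼b
    b∈letters : Any (b ≈_) (letters w)
    b∈letters = SetoidMembershipₚ.∈-deduplicate⁺ Eq.setoid _≟_ (λ c≈d e≈c → Eq.trans e≈c (Eq.sym c≈d))
      (Any.map Eq.reflexive (VecMembershipₚ.∈-toList⁺ b∈))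

  packVec-≤ : (w : Vec Letter n) → ∀ i j →
              lookup (packVec w) i ≤ lookup (packVec w) j ⇔ lookup w i ≼ lookup w j
  packVec-≤ w i j rewrite Vecₚ.lookup-map i (rank w) w | Vecₚ.lookup-map j (rank w) w =
    mk⇔ (rank-cancel w (VecMembershipₚ.∈-lookup i w)) (rank-mono w)

  -- Eliminates ranks: the right-hand side mentions only comparisons, so it can be combined with any
  -- other description of the order, in particular the lexicographic one.
  pack-≡⇔ : (w : Vec Letter n) (v : PackedWord n) →
    pack w ≡ v ⇔ (∀ i j → lookup (word v) i ≤ lookup (word v) j ⇔ lookup w i ≼ lookup w j)
  pack-≡⇔ w v = mk⇔ (λ { refl → packVec-≤ w })
    (λ h → packed-≡ (pack w) v λ i j → ⇔.trans (packVec-≤ w i j) (⇔.sym (h i j)))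

-- Enumeration of the packed words of a given length

wordsOver-unique : {as : List A} → Unique as → ∀ n → Unique (wordsOver as n)
wordsOver-unique as! zero    = [] ∷ []
wordsOver-unique as! (suc n) =
  Uniqueₚ.cartesianProductWith⁺ _∷_ Vecₚ.∷-injective as! (wordsOver-unique as! n)

∈-wordsOver⁺ : {as : List A} (w : Vec A n) → (∀ {x} → x ∈ w → x L.∈ as) → w L.∈ wordsOver as n
∈-wordsOver⁺ []      w⊆as = here refl
∈-wordsOver⁺ (x ∷ w) w⊆as =
  ∈ₚ.∈-cartesianProductWith⁺ _∷_ (w⊆as (VecAny.here refl)) (∈-wordsOver⁺ w (w⊆as ∘ VecAny.there))

∈-wordsOver⁻ : {as : List A} {w : Vec A n} → w L.∈ wordsOver as n → ∀ {x} → x ∈ w → x L.∈ as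
∈-wordsOver⁻ {n = suc n} {as = as} w∈ x∈
  with _ , v , a∈ , v∈ , refl ← ∈ₚ.∈-cartesianProductWith⁻ _∷_ as (wordsOver as n) w∈
  with x∈
... | VecAny.here refl = a∈
... | VecAny.there x∈v = ∈-wordsOver⁻ v∈ x∈v

private
  -- The mapped function is local to `packedWords`; unification against `refl` makes it accessible
  -- as the first component.
  packedWords-mapMaybe : ∀ n → ∃ λ f → packedWords n ≡ mapMaybe f (wordsOver (range n) n)
  packedWords-mapMaybe n = _ , refl

map-mapMaybe : ∀ {p} {P : Pred A p} (P? : Decidable P) (f : A → Maybe B) (g : B → A) →
  (∀ x → (∃ λ y → f x ≡ just y × g y ≡ x × P x) ⊎ (f x ≡ nothing × ¬ P x)) →
  ∀ xs → map g (mapMaybe f xs) ≡ filter P? xs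
map-mapMaybe P? f g spec []       = refl
map-mapMaybe P? f g spec (x ∷ xs) with f x | spec x
... | _ | inj₁ (y , refl , gy≡x , px) =
  trans (cong₂ _∷_ gy≡x (map-mapMaybe P? f g spec xs)) (sym (Listₚ.filter-accept P? px))
... | _ | inj₂ (refl , ¬px) =
  trans (map-mapMaybe P? f g spec xs) (sym (Listₚ.filter-reject P? ¬px))

-- Replaces the partial map by a filter on plain vectors, where absence of repetitions and
-- membership are easily read off.
map-word-packedWords : ∀ n → map word (packedWords n) ≡ filter isPacked? (wordsOver (range n) n)
map-word-packedWords n =
  map-mapMaybe isPacked? (proj₁ (packedWords-mapMaybe n)) word spec (wordsOver (range n) n)
  where
  spec : ∀ w → (∃ λ u → proj₁ (packedWords-mapMaybe n) w ≡ just u × word u ≡ w × IsPacked w) ⊎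
               (proj₁ (packedWords-mapMaybe n) w ≡ nothing × ¬ IsPacked w)
  spec w with isPacked? w
  ... | yes p = inj₁ (packedWord w p , refl , refl , p)
  ... | no ¬p = inj₂ (refl , ¬p)

packedWords-unique : ∀ n → Unique (packedWords n)
packedWords-unique n = Uniqueₚ.map⁻ (subst Unique (sym (map-word-packedWords n))
  (Uniqueₚ.filter⁺ isPacked? (wordsOver-unique (Uniqueₚ.map⁺ ℕₚ.suc-injective (Uniqueₚ.upTo⁺ n)) n)))

-- Distinct letters occur at distinct positions, so there are at most n of them.
packed-letter-≤length : (u : PackedWord n) → ∀ {i} → i ∈ word u → 1 ≤ i × i ≤ n
packed-letter-≤length u i∈ =
  let r , h = isPacked u
      1≤i , i≤r = to (h _) i∈
      position : Fin r → Fin _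
      position k = proj₁ (∈⇒lookup (from (h (suc (Fin.toℕ k))) (s≤s z≤n , Finₚ.toℕ<n k)))
      letterAt : ∀ k → lookup (word u) (position k) ≡ suc (Fin.toℕ k)
      letterAt k = proj₂ (∈⇒lookup (from (h (suc (Fin.toℕ k))) (s≤s z≤n , Finₚ.toℕ<n k)))
      r≤n = Finₚ.injective⇒≤ {f = position} λ {k} {l} eq →
        Finₚ.toℕ-injective (ℕₚ.suc-injective
          (trans (sym (letterAt k)) (trans (cong (lookup (word u)) eq) (letterAt l))))
  in 1≤i , ℕₚ.≤-trans i≤r r≤n

∈-packedWords : (u : PackedWord n) → u L.∈ packedWords n
∈-packedWords {n} u
  with v , v∈ , eq ← ∈ₚ.∈-map⁻ word (subst (word u L.∈_) (sym (map-word-packedWords n))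
         (∈ₚ.∈-filter⁺ isPacked? (∈-wordsOver⁺ (word u) λ i∈ →
           let 1≤i , i≤n = packed-letter-≤length u i∈ in ∈-range⁺ 1≤i i≤n) (isPacked u)))
  = subst (L._∈ packedWords n) (sym (word-injective eq)) v∈

-- Sums and products of natural numbers over lists

⟦_⟧ : ∀ {p} {P : Set p} → Dec P → ℕ
⟦ yes _ ⟧ = 1
⟦ no  _ ⟧ = 0

⟦⟧-cong : ∀ {p q} {P : Set p} {Q : Set q} (P? : Dec P) (Q? : Dec Q) → P ⇔ Q → ⟦ P? ⟧ ≡ ⟦ Q? ⟧
⟦⟧-cong (yes p) (yes q) P⇔Q = refl
⟦⟧-cong (yes p) (no ¬q) P⇔Q = contradiction (to P⇔Q p) ¬q
⟦⟧-cong (no ¬p) (yes q) P⇔Q = contradiction (from P⇔Q q) ¬p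
⟦⟧-cong (no ¬p) (no ¬q) P⇔Q = refl

⟦⟧-yes : ∀ {p} {P : Set p} (P? : Dec P) → P → ⟦ P? ⟧ ≡ 1
⟦⟧-yes (yes _) p = refl
⟦⟧-yes (no ¬p) p = contradiction p ¬p

⟦⟧-no : ∀ {p} {P : Set p} (P? : Dec P) → ¬ P → ⟦ P? ⟧ ≡ 0
⟦⟧-no (yes p) ¬p = contradiction p ¬p
⟦⟧-no (no _)  ¬p = refl

sumOver : List A → (A → ℕ) → ℕ
sumOver xs f = foldr (λ x s → f x + s) 0 xs

productOver : List A → (A → ℕ) → ℕ
productOver xs f = foldr (λ x p → f x * p) 1 xs

sumOver-cong : (xs : List A) {f g : A → ℕ} → (∀ {x} → x L.∈ xs → f x ≡ g x) →
               sumOver xs f ≡ sumOver xs g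
sumOver-cong []       f≗g = refl
sumOver-cong (x ∷ xs) f≗g = cong₂ _+_ (f≗g (here refl)) (sumOver-cong xs (f≗g ∘ there))

productOver-cong : (xs : List A) {f g : A → ℕ} → (∀ {x} → x L.∈ xs → f x ≡ g x) →
                   productOver xs f ≡ productOver xs g
productOver-cong []       f≗g = refl
productOver-cong (x ∷ xs) f≗g = cong₂ _*_ (f≗g (here refl)) (productOver-cong xs (f≗g ∘ there))

sumOver-zero : (xs : List A) {f : A → ℕ} → (∀ {x} → x L.∈ xs → f x ≡ 0) → sumOver xs f ≡ 0
sumOver-zero []       f≗0 = refl
sumOver-zero (x ∷ xs) f≗0 = cong₂ _+_ (f≗0 (here refl)) (sumOver-zero xs (f≗0 ∘ there))

sumOver-+ : (xs : List A) (f g : A → ℕ) →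
            sumOver xs (λ x → f x + g x) ≡ sumOver xs f + sumOver xs g
sumOver-+ []       f g = refl
sumOver-+ (x ∷ xs) f g =
  trans (cong (f x + g x +_) (sumOver-+ xs f g)) (interchange (f x) (g x) _ _)
  where
  interchange : ∀ a b c d → a + b + (c + d) ≡ a + c + (b + d)
  interchange = solve-∀

sumOver-*ˡ : (xs : List A) (k : ℕ) (f : A → ℕ) → sumOver xs (λ x → k * f x) ≡ k * sumOver xs f
sumOver-*ˡ []       k f = sym (ℕₚ.*-zeroʳ k)
sumOver-*ˡ (x ∷ xs) k f =
  trans (cong (k * f x +_) (sumOver-*ˡ xs k f)) (sym (ℕₚ.*-distribˡ-+ k (f x) _))

sumOver-*ʳ : (xs : List A) (k : ℕ) (f : A → ℕ) → sumOver xs (λ x → f x * k) ≡ sumOver xs f * k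
sumOver-*ʳ []       k f = refl
sumOver-*ʳ (x ∷ xs) k f =
  trans (cong (f x * k +_) (sumOver-*ʳ xs k f)) (sym (ℕₚ.*-distribʳ-+ k (f x) _))

sumOver-swap : (xs : List A) (ys : List B) (f : A → B → ℕ) →
  sumOver xs (λ x → sumOver ys (f x)) ≡ sumOver ys (λ y → sumOver xs (λ x → f x y))
sumOver-swap []       ys f = sym (sumOver-zero ys (λ _ → refl))
sumOver-swap (x ∷ xs) ys f =
  trans (cong (sumOver ys (f x) +_) (sumOver-swap xs ys f)) (sym (sumOver-+ ys (f x) _))

sumOver-++ : (xs ys : List A) (f : A → ℕ) → sumOver (xs ++ ys) f ≡ sumOver xs f + sumOver ys f
sumOver-++ []       ys f = refl
sumOver-++ (x ∷ xs) ys f =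
  trans (cong (f x +_) (sumOver-++ xs ys f)) (sym (ℕₚ.+-assoc (f x) _ _))

sumOver-map : (g : A → B) (xs : List A) (f : B → ℕ) → sumOver (map g xs) f ≡ sumOver xs (f ∘ g)
sumOver-map g []       f = refl
sumOver-map g (x ∷ xs) f = cong (f (g x) +_) (sumOver-map g xs f)

sumOver-cartesianProductWith : (_∙_ : A → B → C′) (xs : List A) (ys : List B) (f : C′ → ℕ) →
  sumOver (cartesianProductWith _∙_ xs ys) f ≡ sumOver xs (λ x → sumOver ys (λ y → f (x ∙ y)))
sumOver-cartesianProductWith _∙_ []       ys f = refl
sumOver-cartesianProductWith _∙_ (x ∷ xs) ys f =
  trans (sumOver-++ (map (x ∙_) ys) _ f)
        (cong₂ _+_ (sumOver-map (x ∙_) ys f) (sumOver-cartesianProductWith _∙_ xs ys f))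

sumOver-⟦⟧ : ∀ {p} {P : Pred A p} (P? : Decidable P) (xs : List A) →
             sumOver xs (λ x → ⟦ P? x ⟧) ≡ length (filter P? xs)
sumOver-⟦⟧ P? []       = refl
sumOver-⟦⟧ P? (x ∷ xs) with P? x
... | yes _ = cong suc (sumOver-⟦⟧ P? xs)
... | no  _ = sumOver-⟦⟧ P? xs

sumOver-filter : ∀ {p} {P : Pred A p} (P? : Decidable P) (xs : List A) (f : A → ℕ) →
  sumOver (filter P? xs) f ≡ sumOver xs (λ x → ⟦ P? x ⟧ * f x)
sumOver-filter P? []       f = refl
sumOver-filter P? (x ∷ xs) f with P? x
... | yes _ = cong₂ _+_ (sym (ℕₚ.+-identityʳ (f x))) (sumOver-filter P? xs f)
... | no  _ = sumOver-filter P? xs f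

-- Only the term at y survives, and it occurs once because the list has no repetitions. The
-- predicate is merely equivalent to x ≡ y, so that equality tests in either order can be used.
sumOver-sift : ∀ {p} {P : Pred A p} (P? : Decidable P) {xs : List A} {y : A} →
  Unique xs → y L.∈ xs → (∀ {x} → P x ⇔ x ≡ y) → (f : A → ℕ) →
  sumOver xs (λ x → ⟦ P? x ⟧ * f x) ≡ f y
sumOver-sift P? {x ∷ xs} {y} (x∉xs ∷ _) (here refl) P⇔ f = begin
  ⟦ P? y ⟧ * f y + sumOver xs (λ x → ⟦ P? x ⟧ * f x)
    ≡⟨ cong₂ _+_ (cong (_* f y) (⟦⟧-yes (P? y) (from P⇔ refl)))
         (sumOver-zero xs λ {x} x∈ → cong (_* f x)
           (⟦⟧-no (P? x) λ Px → All.lookup x∉xs x∈ (sym (to P⇔ Px)))) ⟩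
  1 * f y + 0 ≡⟨ trans (ℕₚ.+-identityʳ _) (ℕₚ.*-identityˡ (f y)) ⟩
  f y         ∎
  where open ≡-Reasoning
sumOver-sift P? {x ∷ xs} {y} (x∉xs ∷ xs!) (there y∈) P⇔ f =
  cong₂ _+_ (cong (_* f x) (⟦⟧-no (P? x) λ Px → All.lookup x∉xs y∈ (to P⇔ Px)))
            (sumOver-sift P? xs! y∈ P⇔ f)

productOver-⟦⟧ : ∀ {p} {P : Pred A p} (P? : Decidable P) (xs : List A) →
                 productOver xs (λ x → ⟦ P? x ⟧) ≡ ⟦ All.all? P? xs ⟧
productOver-⟦⟧ P? []       = refl
productOver-⟦⟧ P? (x ∷ xs) rewrite productOver-⟦⟧ P? xs with P? x | All.all? P? xs
... | yes _ | yes _ = refl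
... | yes _ | no  _ = refl
... | no  _ | _     = refl

-- The summation variable affects the factor at j alone, so all other factors leave the sum. In
-- `sumOver-subwords` this absorbs the sum over one new letter into the factor of the block to which
-- its position belongs.
sumOver-productOver : (xs : List A) (F : A → B → ℕ) (G : B → ℕ) {j : B} {is : List B} →
  Unique is → j L.∈ is → G j ≡ sumOver xs (λ x → F x j) → (∀ {i} → i ≢ j → ∀ x → F x i ≡ G i) →
  sumOver xs (λ x → productOver is (F x)) ≡ productOver is G
sumOver-productOver xs F G {j} {j ∷ is} (j∉is ∷ _) (here refl) Gj F≡G = begin
  sumOver xs (λ x → F x j * productOver is (F x))
    ≡⟨ sumOver-cong xs (λ {x} _ → cong (F x j *_)
         (productOver-cong is λ i∈ → F≡G (λ i≡j → All.lookup j∉is i∈ (sym i≡j)) x)) ⟩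
  sumOver xs (λ x → F x j * productOver is G) ≡⟨ sumOver-*ʳ xs (productOver is G) _ ⟩
  sumOver xs (λ x → F x j) * productOver is G ≡⟨ cong (_* productOver is G) Gj ⟨
  G j * productOver is G                      ∎
  where open ≡-Reasoning
sumOver-productOver xs F G {j} {i ∷ is} (i∉is ∷ is!) (there j∈) Gj F≡G = begin
  sumOver xs (λ x → F x i * productOver is (F x))
    ≡⟨ sumOver-cong xs (λ {x} _ → cong (_* productOver is (F x)) (F≡G (All.lookup i∉is j∈) x)) ⟩
  sumOver xs (λ x → G i * productOver is (F x)) ≡⟨ sumOver-*ˡ xs (G i) _ ⟩
  G i * sumOver xs (λ x → productOver is (F x))
    ≡⟨ cong (G i *_) (sumOver-productOver xs F G is! j∈ Gj F≡G) ⟩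
  G i * productOver is G ∎
  where open ≡-Reasoning

unique-sameElements⇒length≡ : {xs ys : List A} → Unique xs → Unique ys →
  (∀ {x} → x L.∈ xs ⇔ x L.∈ ys) → length xs ≡ length ys
unique-sameElements⇒length≡ xs! ys! xs∼ys = ↭-length (∼bag⇒↭ (unique∧set⇒bag xs! ys! xs∼ys))

max-∈ : (u : PackedWord n) → ∀ {i} → i ∈ word u ⇔ (1 ≤ i × i ≤ max u)
max-∈ u {i} = mk⇔
  (λ i∈ → proj₁ (to (h i) i∈) , ∈⇒≤maxLetter i∈)
  (λ (1≤i , i≤max) → from (h i) (1≤i , ℕₚ.≤-trans i≤max (maxLetter≤ (word u) λ j∈ → proj₂ (to (h _) j∈))))
  where h = proj₂ (isPacked u)

-- Strictly decreasing words

decreasingWords : (q m : ℕ) → List (Vec ℕ m)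
decreasingWords q       zero    = [] ∷ []
decreasingWords zero    (suc m) = []
decreasingWords (suc q) (suc m) = map (q ∷_) (decreasingWords q m) ++ decreasingWords q (suc m)

-- The recursion of `decreasingWords` splits by whether the largest available letter is used, which
-- is Pascal's rule.
length-decreasingWords : ∀ q m → length (decreasingWords q m) ≡ q C m
length-decreasingWords q       zero    = sym (trans (nCk≡nC[n∸k] {n = q} z≤n) (nCn≡1 q))
length-decreasingWords zero    (suc m) = refl
length-decreasingWords (suc q) (suc m) = begin
  length (map (q ∷_) (decreasingWords q m) ++ decreasingWords q (suc m))
    ≡⟨ Listₚ.length-++ (map (q ∷_) (decreasingWords q m)) ⟩
  length (map (q ∷_) (decreasingWords q m)) + length (decreasingWords q (suc m))
    ≡⟨ cong₂ _+_ (trans (Listₚ.length-map (q ∷_) (decreasingWords q m)) (length-decreasingWords q m))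
                 (length-decreasingWords q (suc m)) ⟩
  q C m + q C suc m ≡⟨ nCk+nC[k+1]≡[n+1]C[k+1] q m ⟩
  suc q C suc m     ∎
  where open ≡-Reasoning

-- A decreasing word s of length m encodes the increasing map k ↦ at s k on {1,…,m}:
-- the first letter of s is the image of m.
at : ∀ {m} → Vec ℕ m → ℕ → ℕ
at             []      k = 0
at {m = suc m} (a ∷ s) k with k ℕₚ.≟ suc m
... | yes _ = a
... | no  _ = at s k

at-injective : ∀ {m} (s t : Vec ℕ m) → (∀ {k} → 1 ≤ k → k ≤ m → at s k ≡ at t k) → s ≡ t
at-injective         []      []      eq = refl
at-injective {suc m} (a ∷ s) (b ∷ t) eq = cong₂ _∷_ heads (at-injective s t tails)
  where
  heads : a ≡ b
  heads with suc m ℕₚ.≟ suc m | eq {suc m} (s≤s z≤n) ℕₚ.≤-refl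
  ... | yes _ | a≡b = a≡b
  ... | no ≢  | _   = contradiction refl ≢
  tails : ∀ {k} → 1 ≤ k → k ≤ m → at s k ≡ at t k
  tails {k} 1≤k k≤m with k ℕₚ.≟ suc m | eq 1≤k (ℕₚ.m≤n⇒m≤1+n k≤m)
  ... | yes refl | _  = contradiction k≤m ℕₚ.1+n≰n
  ... | no _     | e = e

private
  ≢⇒≤pred : ∀ {k m} → k ≤ suc m → k ≢ suc m → k ≤ m
  ≢⇒≤pred k≤1+m k≢1+m = ℕₚ.≤-pred (ℕₚ.≤∧≢⇒< k≤1+m k≢1+m)

at-< : ∀ q {m} {s : Vec ℕ m} → s L.∈ decreasingWords q m → ∀ {k} → 1 ≤ k → k ≤ m → at s k < q
at-< q       {zero}  _  (s≤s _) ()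
at-< (suc q) {suc m} s∈ {k} 1≤k k≤
  with ∈ₚ.∈-++⁻ (map (q ∷_) (decreasingWords q m)) s∈
... | inj₂ s∈′ = ℕₚ.m<n⇒m<1+n (at-< q s∈′ 1≤k k≤)
... | inj₁ s∈′ with s , s∈″ , refl ← ∈ₚ.∈-map⁻ (q ∷_) s∈′ with k ℕₚ.≟ suc m
...   | yes _ = ℕₚ.≤-refl
...   | no k≢ = ℕₚ.m<n⇒m<1+n (at-< q s∈″ 1≤k (≢⇒≤pred k≤ k≢))

at-strictMono : ∀ q {m} {s : Vec ℕ m} → s L.∈ decreasingWords q m →
                ∀ {k l} → 1 ≤ k → k < l → l ≤ m → at s k < at s l
at-strictMono q       {zero}  _  _ (s≤s _) ()
at-strictMono (suc q) {suc m} s∈ {k} {l} 1≤k k<l l≤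
  with ∈ₚ.∈-++⁻ (map (q ∷_) (decreasingWords q m)) s∈
... | inj₂ s∈′ = at-strictMono q s∈′ 1≤k k<l l≤
... | inj₁ s∈′ with s , s∈″ , refl ← ∈ₚ.∈-map⁻ (q ∷_) s∈′ with k ℕₚ.≟ suc m | l ℕₚ.≟ suc m
...   | yes refl | _     = contradiction (ℕₚ.<-≤-trans k<l l≤) (ℕₚ.<-irrefl refl)
-- The value at the top index is q, while the remaining letters come from a word over the letters
-- below q.
...   | no k≢ | yes refl = at-< q s∈″ 1≤k (ℕₚ.≤-pred k<l)
...   | no k≢ | no l≢    = at-strictMono q s∈″ 1≤k k<l (≢⇒≤pred l≤ l≢)

decreasingWords-unique : ∀ q m → Unique (decreasingWords q m)
decreasingWords-unique q       zero    = [] ∷ []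
decreasingWords-unique zero    (suc m) = []
decreasingWords-unique (suc q) (suc m) =
  Uniqueₚ.++⁺ (Uniqueₚ.map⁺ Vecₚ.∷-injectiveʳ (decreasingWords-unique q m))
              (decreasingWords-unique q (suc m))
              disjoint
  where
  disjoint : ∀ {s} → ¬ (s L.∈ map (q ∷_) (decreasingWords q m) × s L.∈ decreasingWords q (suc m))
  disjoint (s∈ , s∈′) with s , s∈″ , refl ← ∈ₚ.∈-map⁻ (q ∷_) s∈
    -- A common word would have the value q at its top index, yet all values of a word in the second
    -- list are below q.
    with suc m ℕₚ.≟ suc m | at-< q s∈′ {suc m} (s≤s z≤n) ℕₚ.≤-refl
  ... | yes _ | q<q = ℕₚ.<-irrefl refl q<q
  ... | no ≢  | _   = ≢ refl

-- The increasing map is given by a relation, since in the application the image of k is read off at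
-- some position where v has the letter k, and that position has to be chosen. No single-valuedness
-- is asked of R; the values of s are only required to be related by it.
decreasingWords-complete : ∀ q m (R : ℕ → ℕ → Set) →
  (∀ {k l a b} → R k a → R l b → k < l → a < b) →
  (∀ {k} → 1 ≤ k → k ≤ m → ∃ λ a → a < q × R k a) →
  ∃ λ s → s L.∈ decreasingWords q m × (∀ {k} → 1 ≤ k → k ≤ m → R k (at s k))
decreasingWords-complete q       zero    R mono image = [] , here refl , λ { (s≤s _) () }
decreasingWords-complete zero    (suc m) R mono image
  with _ , () , _ ← image (s≤s z≤n) (s≤s z≤n)
decreasingWords-complete (suc q) (suc m) R mono image
  with a , a<1+q , Ra ← image (s≤s z≤n) ℕₚ.≤-refl
  with a ℕₚ.≟ q
... | yes refl =
  let s , s∈ , Rs = decreasingWords-complete q m R mono λ 1≤k k≤m →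
        let b , _ , Rb = image 1≤k (ℕₚ.m≤n⇒m≤1+n k≤m) in b , mono Rb Ra (s≤s k≤m) , Rb
  in q ∷ s , ∈ₚ.∈-++⁺ˡ (∈ₚ.∈-map⁺ (q ∷_) s∈) , extend s Rs
  where
  extend : (s : Vec ℕ m) → (∀ {k} → 1 ≤ k → k ≤ m → R k (at s k)) →
           ∀ {k} → 1 ≤ k → k ≤ suc m → R k (at (q ∷ s) k)
  extend s Rs {k} 1≤k k≤1+m with k ℕₚ.≟ suc m
  ... | yes refl = Ra
  ... | no k≢    = Rs 1≤k (≢⇒≤pred k≤1+m k≢)
-- By monotonicity the image of the top index exceeds all others; as it is below q, the letter q can
-- be discarded and the same m kept.
... | no a≢q =
  let s , s∈ , Rs = decreasingWords-complete q (suc m) R mono image<q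
  in s , ∈ₚ.∈-++⁺ʳ (map (q ∷_) (decreasingWords q m)) s∈ , Rs
  where
  a<q : a < q
  a<q = ℕₚ.≤∧≢⇒< (ℕₚ.≤-pred a<1+q) a≢q
  image<q : ∀ {k} → 1 ≤ k → k ≤ suc m → ∃ λ b → b < q × R k b
  image<q {k} 1≤k k≤1+m with k ℕₚ.≟ suc m
  ... | yes refl = a , a<q , Ra
  ... | no k≢    = let b , _ , Rb = image 1≤k k≤1+m in
    b , ℕₚ.<-trans (mono Rb Ra (ℕₚ.≤∧≢⇒< k≤1+m k≢)) a<q , Rb

-- A word over {0,…,q-1} packing to v is the image of v under a strictly increasing map
-- {1,…,max v} → {0,…,q-1}.
count-packings : ∀ q (v : PackedWord n) →
  sumOver (wordsOver (upTo q) n) (λ x → ⟦ packℕ x ≟ᴾ v ⟧) ≡ q C max v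
count-packings {n} q v = begin
  sumOver words (λ x → ⟦ packℕ x ≟ᴾ v ⟧) ≡⟨ sumOver-⟦⟧ (λ x → packℕ x ≟ᴾ v) words ⟩
  length (filter (λ x → packℕ x ≟ᴾ v) words)
    ≡⟨ unique-sameElements⇒length≡
         (Uniqueₚ.filter⁺ (λ x → packℕ x ≟ᴾ v) (wordsOver-unique (Uniqueₚ.upTo⁺ q) n))
         (Uniqueₚ.map⁺ image-injective (decreasingWords-unique q m))
         (mk⇔ to′ from′) ⟩
  length (map image (decreasingWords q m)) ≡⟨ Listₚ.length-map image (decreasingWords q m) ⟩
  length (decreasingWords q m)             ≡⟨ length-decreasingWords q m ⟩
  q C m                                    ∎
  where
  open ≡-Reasoning
  open PackingProperties ℕₚ.≤-decTotalOrder
  m = max v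
  words = wordsOver (upTo q) n

  image : Vec ℕ m → Vec ℕ n
  image s = Vec.map (at s) (word v)

  letter-bounds : ∀ i → 1 ≤ lookup (word v) i × lookup (word v) i ≤ m
  letter-bounds i = to (max-∈ v) (VecMembershipₚ.∈-lookup i (word v))

  image-injective : ∀ {s t} → image s ≡ image t → s ≡ t
  image-injective {s} {t} eq = at-injective s t λ 1≤k k≤m →
    let i , vᵢ≡k = ∈⇒lookup (from (max-∈ v) (1≤k , k≤m)) in
    subst (λ k → at s k ≡ at t k) vᵢ≡k
      (trans (sym (Vecₚ.lookup-map i (at s) (word v)))
        (trans (cong (λ x → lookup x i) eq) (Vecₚ.lookup-map i (at t) (word v))))

  to′ : ∀ {x} → x L.∈ filter (λ x → packℕ x ≟ᴾ v) words → x L.∈ map image (decreasingWords q m)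
  to′ {x} x∈ =
    let x∈words , pack-x≡v = ∈ₚ.∈-filter⁻ (λ x → packℕ x ≟ᴾ v) {xs = words} x∈
        v⇔x = to (pack-≡⇔ x v) pack-x≡v
        R = λ k a → ∃ λ i → lookup (word v) i ≡ k × lookup x i ≡ a
        s , s∈ , Rs = decreasingWords-complete q m R
          (λ { (i , refl , refl) (j , refl , refl) vᵢ<vⱼ →
               ℕₚ.≰⇒> λ xⱼ≤xᵢ → ℕₚ.<⇒≱ vᵢ<vⱼ (from (v⇔x j i) xⱼ≤xᵢ) })
          (λ 1≤k k≤m → let i , vᵢ≡k = ∈⇒lookup (from (max-∈ v) (1≤k , k≤m)) in
             lookup x i , ∈ₚ.∈-upTo⁻ (∈-wordsOver⁻ x∈words (VecMembershipₚ.∈-lookup i x)) ,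
             i , vᵢ≡k , refl)
    in subst (L._∈ map image (decreasingWords q m))
         -- The value chosen for the letter vᵢ comes from some position j with vⱼ = vᵢ; equal
         -- letters of v force equal letters of x, so the choice does not matter.
         (lookup-extensional λ i →
           let j , vⱼ≡vᵢ , xⱼ≡ = Rs (proj₁ (letter-bounds i)) (proj₂ (letter-bounds i)) in
           trans (Vecₚ.lookup-map i (at s) (word v)) (trans (sym xⱼ≡)
             (ℕₚ.≤-antisym (to (v⇔x j i) (ℕₚ.≤-reflexive vⱼ≡vᵢ))
                           (to (v⇔x i j) (ℕₚ.≤-reflexive (sym vⱼ≡vᵢ))))))
         (∈ₚ.∈-map⁺ image s∈)

  from′ : ∀ {x} → x L.∈ map image (decreasingWords q m) → x L.∈ filter (λ x → packℕ x ≟ᴾ v) words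
  from′ x∈ with s , s∈ , refl ← ∈ₚ.∈-map⁻ image x∈ =
    ∈ₚ.∈-filter⁺ (λ x → packℕ x ≟ᴾ v)
      (∈-wordsOver⁺ (image s) letter-∈)
      (from (pack-≡⇔ (image s) v) v⇔image)
    where
    letter-∈ : ∀ {a} → a ∈ image s → a L.∈ upTo q
    letter-∈ a∈ with k , k∈ , refl ← ∈-mapVec⁻ (at s) a∈ =
      ∈ₚ.∈-upTo⁺ (at-< q s∈ (proj₁ (to (max-∈ v) k∈)) (proj₂ (to (max-∈ v) k∈)))
    v⇔image : ∀ i j → lookup (word v) i ≤ lookup (word v) j ⇔ lookup (image s) i ≤ lookup (image s) j
    v⇔image i j rewrite Vecₚ.lookup-map i (at s) (word v) | Vecₚ.lookup-map j (at s) (word v)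
      with ℕₚ.<-cmp (lookup (word v) i) (lookup (word v) j)
    ... | tri< vᵢ<vⱼ _ _ = mk⇔
      (λ _ → ℕₚ.<⇒≤ (at-strictMono q s∈ (proj₁ (letter-bounds i)) vᵢ<vⱼ (proj₂ (letter-bounds j))))
      (λ _ → ℕₚ.<⇒≤ vᵢ<vⱼ)
    ... | tri≈ _ vᵢ≡vⱼ _ = mk⇔
      (λ _ → ℕₚ.≤-reflexive (cong (at s) vᵢ≡vⱼ))
      (λ _ → ℕₚ.≤-reflexive vᵢ≡vⱼ)
    ... | tri> _ _ vⱼ<vᵢ = mk⇔
      (λ vᵢ≤vⱼ → contradiction vᵢ≤vⱼ (ℕₚ.<⇒≱ vⱼ<vᵢ))
      (λ atᵢ≤atⱼ → contradiction atᵢ≤atⱼ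
        (ℕₚ.<⇒≱ (at-strictMono q s∈ (proj₁ (letter-bounds j)) vⱼ<vᵢ (proj₂ (letter-bounds i)))))

-- Subwords at the blocks of u

-- By definition, subwordAt u w is subword (word u) (word w).
subword : Vec ℕ n → Vec A n → ℕ → List A
subword u x i = map proj₂ (filter (λ (uⱼ , _) → uⱼ ℕₚ.≟ i) (toList (Vec.zip u x)))

-- The effect of one more position on a subword, as a function of the decision, so that it can be
-- composed with the weight `F` in the induction below.
consIf : ∀ {p} {P : Set p} → Dec P → A → List A → List A
consIf (yes _) a y = a ∷ y
consIf (no  _) a y = y

consIf-yes : ∀ {p} {P : Set p} (P? : Dec P) → P → (a : A) (y : List A) → consIf P? a y ≡ a ∷ y
consIf-yes (yes _) p a y = refl
consIf-yes (no ¬p) p a y = contradiction p ¬p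

consIf-no : ∀ {p} {P : Set p} (P? : Dec P) → ¬ P → (a : A) (y : List A) → consIf P? a y ≡ y
consIf-no (yes p) ¬p a y = contradiction p ¬p
consIf-no (no _)  ¬p a y = refl

subword-∷ : ∀ b (u : Vec ℕ n) a (x : Vec A n) i →
            subword (b ∷ u) (a ∷ x) i ≡ consIf (b ℕₚ.≟ i) a (subword u x i)
subword-∷ b u a x i = go (b ℕₚ.≟ i)
  where
  go : (b≟i : Dec (b ≡ i)) → subword (b ∷ u) (a ∷ x) i ≡ consIf b≟i a (subword u x i)
  go (yes b≡i) = cong (map proj₂) (Listₚ.filter-accept (λ (uⱼ , _) → uⱼ ℕₚ.≟ i) b≡i)
  go (no  b≢i) = cong (map proj₂) (Listₚ.filter-reject (λ (uⱼ , _) → uⱼ ℕₚ.≟ i) b≢i)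

-- A word amounts to the family of its subwords at the letters of u. The word z only
-- serves to measure the lengths of these subwords.
sumOver-subwords : (as : List A) (u : Vec ℕ n) (z : Vec B n) {is : List ℕ} → Unique is →
  (∀ {i} → i ∈ u → i L.∈ is) → (F : ℕ → List A → ℕ) →
  sumOver (wordsOver as n) (λ x → productOver is (λ i → F i (subword u x i))) ≡
  productOver is (λ i → sumOver (wordsOver as (length (subword u z i))) (λ y → F i (toList y)))
sumOver-subwords as []      []      {is} is! u⊆is F = trans (ℕₚ.+-identityʳ _)
  (productOver-cong is λ {i} _ → sym (ℕₚ.+-identityʳ (F i [])))
sumOver-subwords {n = suc n} as (b ∷ u) (c ∷ z) {is} is! u⊆is F = begin
  sumOver (wordsOver as (suc n)) (λ x → productOver is (λ i → F i (subword (b ∷ u) x i)))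
    ≡⟨ sumOver-cartesianProductWith _∷_ as (wordsOver as n) _ ⟩
  sumOver as (λ a → sumOver (wordsOver as n) (λ x →
    productOver is (λ i → F i (subword (b ∷ u) (a ∷ x) i))))
    ≡⟨ sumOver-cong as (λ {a} _ → sumOver-cong (wordsOver as n) (λ {x} _ →
         productOver-cong is (λ {i} _ → cong (F i) (subword-∷ b u a x i)))) ⟩
  sumOver as (λ a → sumOver (wordsOver as n) (λ x → productOver is (λ i → Fₐ a i (subword u x i))))
    -- For a fixed first letter a, prefixing a to the subword at b is made part of the weights, and
    -- the induction hypothesis applies to `Fₐ a`.
    ≡⟨ sumOver-cong as (λ {a} _ →
         sumOver-subwords as u z is! (u⊆is ∘ VecAny.there) (Fₐ a)) ⟩
  sumOver as (λ a → productOver is (G a))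
    ≡⟨ sumOver-productOver as G H is! (u⊆is (VecAny.here refl)) H-b H-other ⟩
  productOver is H ∎
  where
  open ≡-Reasoning
  Fₐ : _ → ℕ → List _ → ℕ
  Fₐ a i y = F i (consIf (b ℕₚ.≟ i) a y)
  G : _ → ℕ → ℕ
  G a i = sumOver (wordsOver as (length (subword u z i))) (λ y → Fₐ a i (toList y))
  H : ℕ → ℕ
  H i = sumOver (wordsOver as (length (subword (b ∷ u) (c ∷ z) i))) (λ y → F i (toList y))
  H-b : H b ≡ sumOver as (λ a → G a b)
  H-b rewrite trans (subword-∷ b u c z b) (consIf-yes (b ℕₚ.≟ b) refl c (subword u z b)) =
    trans (sumOver-cartesianProductWith _∷_ as (wordsOver as (length (subword u z b))) _)
      (sumOver-cong as λ {a} _ → sumOver-cong (wordsOver as (length (subword u z b))) λ {y} _ →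
        cong (F b) (sym (consIf-yes (b ℕₚ.≟ b) refl a (toList y))))
  H-other : ∀ {i} → i ≢ b → ∀ a → G a i ≡ H i
  H-other {i} i≢b a
    rewrite trans (subword-∷ b u c z i) (consIf-no (b ℕₚ.≟ i) (i≢b ∘ sym) c (subword u z i)) =
    sumOver-cong (wordsOver as (length (subword u z i))) λ {y} _ →
      cong (F i) (consIf-no (b ℕₚ.≟ i) (i≢b ∘ sym) a (toList y))

-- Both subwords select the same positions, so zipping them pairs letters that stood at a common
-- position.
∈-zip-subword⁺ : (u : Vec ℕ n) (x : Vec A n) (w : Vec B n) → ∀ j →
  (lookup x j , lookup w j) L.∈ List.zip (subword u x (lookup u j)) (subword u w (lookup u j))
∈-zip-subword⁺ (b ∷ u) (a ∷ x) (c ∷ w) zero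
  rewrite subword-∷ b u a x b | subword-∷ b u c w b with b ℕₚ.≟ b
... | yes _  = here refl
... | no b≢b = contradiction refl b≢b
∈-zip-subword⁺ (b ∷ u) (a ∷ x) (c ∷ w) (suc j)
  rewrite subword-∷ b u a x (lookup u j) | subword-∷ b u c w (lookup u j) with b ℕₚ.≟ lookup u j
... | yes _ = there (∈-zip-subword⁺ u x w j)
... | no  _ = ∈-zip-subword⁺ u x w j

∈-zip-subword⁻ : (u : Vec ℕ n) (x : Vec A n) (w : Vec B n) → ∀ {i p} →
  p L.∈ List.zip (subword u x i) (subword u w i) →
  ∃ λ j → lookup u j ≡ i × p ≡ (lookup x j , lookup w j)
∈-zip-subword⁻ [] [] [] ()
∈-zip-subword⁻ (b ∷ u) (a ∷ x) (c ∷ w) {i} p∈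
  rewrite subword-∷ b u a x i | subword-∷ b u c w i with b ℕₚ.≟ i | p∈
... | yes b≡i | here p≡  = zero , b≡i , p≡
... | yes b≡i | there p∈ = let j , uⱼ≡i , p≡ = ∈-zip-subword⁻ u x w p∈ in suc j , uⱼ≡i , p≡
... | no  _   | p∈       = let j , uⱼ≡i , p≡ = ∈-zip-subword⁻ u x w p∈ in suc j , uⱼ≡i , p≡

∈-zip-toList⁺ : (x : Vec A n) (w : Vec B n) → ∀ j →
                (lookup x j , lookup w j) L.∈ List.zip (toList x) (toList w)
∈-zip-toList⁺ (a ∷ x) (c ∷ w) zero    = here refl
∈-zip-toList⁺ (a ∷ x) (c ∷ w) (suc j) = there (∈-zip-toList⁺ x w j)

∈-zip-toList⁻ : (x : Vec A n) (w : Vec B n) → ∀ {p} → p L.∈ List.zip (toList x) (toList w) →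
                ∃ λ j → p ≡ (lookup x j , lookup w j)
∈-zip-toList⁻ (a ∷ x) (c ∷ w) (here p≡)  = zero , p≡
∈-zip-toList⁻ (a ∷ x) (c ∷ w) (there p∈) = let j , p≡ = ∈-zip-toList⁻ x w p∈ in suc j , p≡

-- Stated for a list of pairs because the two subwords at i have types that do not record their
-- equal lengths. Its decidability provides the indicator of each block.
SameOrder : List (ℕ × ℕ) → Set
SameOrder ps = All (λ (a , b) → All (λ (c , d) → (a ≤ c → b ≤ d) × (b ≤ d → a ≤ c)) ps) ps

sameOrder? : Decidable SameOrder
sameOrder? ps = All.all? (λ (a , b) → All.all? (λ (c , d) →
  ((a ℕₚ.≤? c) →-dec (b ℕₚ.≤? d)) ×-dec ((b ℕₚ.≤? d) →-dec (a ℕₚ.≤? c))) ps) ps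

-- Links the indicator of a block to the quantity counted by `count-packings`: packing preserves and
-- reflects all comparisons.
sameOrder-toList : (x z : Vec ℕ n) → SameOrder (List.zip (toList x) (toList z)) ⇔ packℕ x ≡ packℕ z
sameOrder-toList x z = ⇔.trans (mk⇔ to′ from′) (⇔.sym (pack-≡⇔ x (packℕ z)))
  where
  open PackingProperties ℕₚ.≤-decTotalOrder
  pz = word (packℕ z)
  to′ : SameOrder (List.zip (toList x) (toList z)) →
        ∀ i j → lookup pz i ≤ lookup pz j ⇔ lookup x i ≤ lookup x j
  to′ so i j =
    let x⇒z , z⇒x = All.lookup (All.lookup so (∈-zip-toList⁺ x z i)) (∈-zip-toList⁺ x z j)
    in ⇔.trans (packVec-≤ z i j) (mk⇔ z⇒x x⇒z)
  from′ : (∀ i j → lookup pz i ≤ lookup pz j ⇔ lookup x i ≤ lookup x j) →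
          SameOrder (List.zip (toList x) (toList z))
  from′ h = All.tabulate λ p∈ → All.tabulate λ q∈ → at-positions
    (∈-zip-toList⁻ x z p∈) (∈-zip-toList⁻ x z q∈)
    where
    at-positions : ∀ {p q : ℕ × ℕ} → (∃ λ i → p ≡ (lookup x i , lookup z i)) →
      (∃ λ j → q ≡ (lookup x j , lookup z j)) →
      (proj₁ p ≤ proj₁ q → proj₂ p ≤ proj₂ q) × (proj₂ p ≤ proj₂ q → proj₁ p ≤ proj₁ q)
    at-positions (i , refl) (j , refl) =
      let z⇔x = ⇔.trans (⇔.sym (packVec-≤ z i j)) (h i j) in from z⇔x , to z⇔x

-- Positions j and k are compared inside the block at i exactly when both carry the letter i in u,
-- and every letter of u lies in `range (max u)`.
sameOrder-subwords : (u : PackedWord n) (x w : Vec ℕ n) →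
  All (λ i → SameOrder (List.zip (subword (word u) x i) (subword (word u) w i))) (range (max u)) ⇔
  (∀ j k → lookup (word u) j ≡ lookup (word u) k →
   lookup w j ≤ lookup w k ⇔ lookup x j ≤ lookup x k)
sameOrder-subwords u x w = mk⇔ to′ from′
  where
  to′ : All (λ i → SameOrder (List.zip (subword (word u) x i) (subword (word u) w i))) (range (max u)) →
        ∀ j k → lookup (word u) j ≡ lookup (word u) k →
        lookup w j ≤ lookup w k ⇔ lookup x j ≤ lookup x k
  to′ so j k uⱼ≡uₖ =
    let 1≤uⱼ , uⱼ≤max = to (max-∈ u) (VecMembershipₚ.∈-lookup j (word u))
        soⱼ = All.lookup so (∈-range⁺ 1≤uⱼ uⱼ≤max)
        k∈ = subst (λ i → (lookup x k , lookup w k) L.∈ List.zip (subword (word u) x i) (subword (word u) w i))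
               (sym uⱼ≡uₖ) (∈-zip-subword⁺ (word u) x w k)
        x⇒w , w⇒x = All.lookup (All.lookup soⱼ (∈-zip-subword⁺ (word u) x w j)) k∈
    in mk⇔ w⇒x x⇒w
  from′ : (∀ j k → lookup (word u) j ≡ lookup (word u) k →
             lookup w j ≤ lookup w k ⇔ lookup x j ≤ lookup x k) →
          All (λ i → SameOrder (List.zip (subword (word u) x i) (subword (word u) w i))) (range (max u))
  from′ h = All.tabulate λ _ → All.tabulate λ p∈ → All.tabulate λ q∈ → at-positions
    (∈-zip-subword⁻ (word u) x w p∈) (∈-zip-subword⁻ (word u) x w q∈)
    where
    at-positions : ∀ {i} {p q : ℕ × ℕ} →
      (∃ λ j → lookup (word u) j ≡ i × p ≡ (lookup x j , lookup w j)) →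
      (∃ λ k → lookup (word u) k ≡ i × q ≡ (lookup x k , lookup w k)) →
      (proj₁ p ≤ proj₁ q → proj₂ p ≤ proj₂ q) × (proj₂ p ≤ proj₂ q → proj₁ p ≤ proj₁ q)
    at-positions (j , uⱼ≡i , refl) (k , uₖ≡i , refl) =
      let w⇔x = h j k (trans uⱼ≡i (sym uₖ≡i)) in from w⇔x , to w⇔x

-- Packing of biwords and its reduction to blocks

module Biwordₚ = PackingProperties (×-decTotalOrder ℕₚ.≤-decTotalOrder ℕₚ.≤-decTotalOrder)

packBiword-≡⇔ : (u x : Vec ℕ n) (w : PackedWord n) →
  packBiword (Vec.zip u x) ≡ w ⇔
  (∀ i j → lookup (word w) i ≤ lookup (word w) j ⇔
     ((lookup u i ≤ lookup u j × lookup u i ≢ lookup u j) ⊎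
      (lookup u i ≡ lookup u j × lookup x i ≤ lookup x j)))
packBiword-≡⇔ u x w = ⇔.trans (Biwordₚ.pack-≡⇔ (Vec.zip u x) w) (mk⇔ to′ from′)
  where
  open DecTotalOrder (×-decTotalOrder ℕₚ.≤-decTotalOrder ℕₚ.≤-decTotalOrder) using () renaming (_≤_ to _≼_)
  to′ : (∀ i j → lookup (word w) i ≤ lookup (word w) j ⇔
           (lookup (Vec.zip u x) i ≼ lookup (Vec.zip u x) j)) →
        ∀ i j → lookup (word w) i ≤ lookup (word w) j ⇔
          ((lookup u i , lookup x i) ≼ (lookup u j , lookup x j))
  to′ h i j = subst₂ (λ p q → lookup (word w) i ≤ lookup (word w) j ⇔ (p ≼ q))
    (Vecₚ.lookup-zip i u x) (Vecₚ.lookup-zip j u x) (h i j)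
  from′ : (∀ i j → lookup (word w) i ≤ lookup (word w) j ⇔
             ((lookup u i , lookup x i) ≼ (lookup u j , lookup x j))) →
          ∀ i j → lookup (word w) i ≤ lookup (word w) j ⇔
            (lookup (Vec.zip u x) i ≼ lookup (Vec.zip u x) j)
  from′ h i j = subst₂ (λ p q → lookup (word w) i ≤ lookup (word w) j ⇔ (p ≼ q))
    (sym (Vecₚ.lookup-zip i u x)) (sym (Vecₚ.lookup-zip j u x)) (h i j)

packBiword-finer : (u w : PackedWord n) (x : Vec ℕ n) →
                   packBiword (Vec.zip (word u) x) ≡ w → w finerThan u
packBiword-finer u w x eq i j wᵢ≤wⱼ with to (to (packBiword-≡⇔ (word u) x w) eq i j) wᵢ≤wⱼ
... | inj₁ (uᵢ≤uⱼ , _) = uᵢ≤uⱼ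
... | inj₂ (uᵢ≡uⱼ , _) = ℕₚ.≤-reflexive uᵢ≡uⱼ

-- Between different blocks of u the top letters decide, and w agrees with them because it is finer;
-- only comparisons within a block constrain x.
packBiword-≡⇔blockwise : (u w : PackedWord n) (x : Vec ℕ n) → w finerThan u →
  packBiword (Vec.zip (word u) x) ≡ w ⇔
  (∀ j k → lookup (word u) j ≡ lookup (word u) k →
   lookup (word w) j ≤ lookup (word w) k ⇔ lookup x j ≤ lookup x k)
packBiword-≡⇔blockwise u w x finer = ⇔.trans (packBiword-≡⇔ (word u) x w) (mk⇔ to′ from′)
  where
  Lex : _ → _ → Set
  Lex i j = (lookup (word u) i ≤ lookup (word u) j × lookup (word u) i ≢ lookup (word u) j) ⊎
            (lookup (word u) i ≡ lookup (word u) j × lookup x i ≤ lookup x j)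
  to′ : (∀ i j → lookup (word w) i ≤ lookup (word w) j ⇔ Lex i j) →
        ∀ j k → lookup (word u) j ≡ lookup (word u) k →
        lookup (word w) j ≤ lookup (word w) k ⇔ lookup x j ≤ lookup x k
  to′ h j k uⱼ≡uₖ = ⇔.trans (h j k) (mk⇔
    (λ { (inj₁ (_ , uⱼ≢uₖ)) → contradiction uⱼ≡uₖ uⱼ≢uₖ ; (inj₂ (_ , xⱼ≤xₖ)) → xⱼ≤xₖ })
    (λ xⱼ≤xₖ → inj₂ (uⱼ≡uₖ , xⱼ≤xₖ)))
  from′ : (∀ j k → lookup (word u) j ≡ lookup (word u) k →
             lookup (word w) j ≤ lookup (word w) k ⇔ lookup x j ≤ lookup x k) →
          ∀ i j → lookup (word w) i ≤ lookup (word w) j ⇔ Lex i j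
  from′ h i j = mk⇔ ≤⇒lex lex⇒≤
    where
    ≤⇒lex : lookup (word w) i ≤ lookup (word w) j → Lex i j
    ≤⇒lex wᵢ≤wⱼ with lookup (word u) i ℕₚ.≟ lookup (word u) j
    ... | yes uᵢ≡uⱼ = inj₂ (uᵢ≡uⱼ , to (h i j uᵢ≡uⱼ) wᵢ≤wⱼ)
    ... | no  uᵢ≢uⱼ = inj₁ (finer i j wᵢ≤wⱼ , uᵢ≢uⱼ)
    lex⇒≤ : Lex i j → lookup (word w) i ≤ lookup (word w) j
    lex⇒≤ (inj₂ (uᵢ≡uⱼ , xᵢ≤xⱼ)) = from (h i j uᵢ≡uⱼ) xᵢ≤xⱼ
    lex⇒≤ (inj₁ (uᵢ≤uⱼ , uᵢ≢uⱼ)) with ℕₚ.≤-total (lookup (word w) i) (lookup (word w) j)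
    ... | inj₁ wᵢ≤wⱼ = wᵢ≤wⱼ
    ... | inj₂ wⱼ≤wᵢ = contradiction (ℕₚ.≤-antisym uᵢ≤uⱼ (finer j i wⱼ≤wᵢ)) uᵢ≢uⱼ

-- Packing the bottom word changes none of its comparisons. This lets a sum over packed words v,
-- weighted by the number of x packing to v, become a sum over the words x themselves.
packBiword-packℕ : (u x : Vec ℕ n) →
                   packBiword (Vec.zip u (word (packℕ x))) ≡ packBiword (Vec.zip u x)
packBiword-packℕ u x = from (packBiword-≡⇔ u (word (packℕ x)) _) λ i j →
  ⇔.trans (to (packBiword-≡⇔ u x _) refl i j) (mk⇔
    (λ { (inj₁ u<) → inj₁ u< ; (inj₂ (u≡ , x≤)) → inj₂ (u≡ , from (packVec-≤ x i j) x≤) })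
    (λ { (inj₁ u<) → inj₁ u< ; (inj₂ (u≡ , x≤)) → inj₂ (u≡ , to (packVec-≤ x i j) x≤) }))
  where open PackingProperties ℕₚ.≤-decTotalOrder

count-biword-packings : ∀ q (u w : PackedWord n) → w finerThan u →
  sumOver (wordsOver (upTo q) n) (λ x → ⟦ packBiword (Vec.zip (word u) x) ≟ᴾ w ⟧) ≡
  productOver (range (max u)) (λ i → q C max (block u w i))
count-biword-packings {n} q u w finer = begin
  sumOver words (λ x → ⟦ packBiword (Vec.zip (word u) x) ≟ᴾ w ⟧)
    ≡⟨ sumOver-cong words (λ {x} _ → ⟦⟧-cong _ (All.all? (λ i → sameOrder? (pairs x i)) (range (max u)))
         (⇔.trans (packBiword-≡⇔blockwise u w x finer) (⇔.sym (sameOrder-subwords u x (word w))))) ⟩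
  sumOver words (λ x → ⟦ All.all? (λ i → sameOrder? (pairs x i)) (range (max u)) ⟧)
    ≡⟨ sumOver-cong words (λ {x} _ → sym (productOver-⟦⟧ (λ i → sameOrder? (pairs x i)) (range (max u)))) ⟩
  sumOver words (λ x → productOver (range (max u)) (λ i → F i (subword (word u) x i)))
    -- Measuring with `word w` yields precisely the lengths that occur in the type of `block u w i`.
    ≡⟨ sumOver-subwords (upTo q) (word u) (word w) range-unique letter-∈ F ⟩
  productOver (range (max u)) (λ i →
    sumOver (wordsOver (upTo q) (length (subwordAt u w i))) (λ y → F i (toList y)))
    ≡⟨ productOver-cong (range (max u)) (λ {i} _ → trans
         (sumOver-cong (wordsOver (upTo q) (length (subwordAt u w i))) (λ {y} _ →
           ⟦⟧-cong (sameOrder? _) (packℕ y ≟ᴾ block u w i) (same-block i y)))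
         (count-packings q (block u w i))) ⟩
  productOver (range (max u)) (λ i → q C max (block u w i)) ∎
  where
  open ≡-Reasoning
  words = wordsOver (upTo q) n
  pairs : Vec ℕ n → ℕ → List (ℕ × ℕ)
  pairs x i = List.zip (subword (word u) x i) (subwordAt u w i)
  F : ℕ → List ℕ → ℕ
  F i y = ⟦ sameOrder? (List.zip y (subwordAt u w i)) ⟧
  range-unique : Unique (range (max u))
  range-unique = Uniqueₚ.map⁺ ℕₚ.suc-injective (Uniqueₚ.upTo⁺ (max u))
  letter-∈ : ∀ {i} → i ∈ word u → i L.∈ range (max u)
  letter-∈ i∈ = let 1≤i , i≤max = to (max-∈ u) i∈ in ∈-range⁺ 1≤i i≤max
  same-block : ∀ i y → SameOrder (List.zip (toList y) (subwordAt u w i)) ⇔ packℕ y ≡ block u w i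
  -- `block` packs `fromList` of the subword, and going back through `toList` is the identity only
  -- propositionally.
  same-block i y = subst (λ l → SameOrder (List.zip (toList y) l) ⇔ packℕ y ≡ block u w i)
    (Vecₚ.toList∘fromList (subwordAt u w i)) (sameOrder-toList y (Vec.fromList (subwordAt u w i)))

-- The identity at a natural number

-- The negation is a dummy: no operation of WQSym* uses it.
ℕ-rawRing : RawRing 0ℓ 0ℓ
ℕ-rawRing = record { Carrier = ℕ ; _≈_ = _≡_ ; _+_ = _+_ ; _*_ = _*_ ; -_ = λ n → n ; 0# = 0 ; 1# = 1 }

module Over-ℕ = WQSym* ℕ-rawRing

module _ where
  open Over-ℕ

  ∑-apply : (xs : List A) (f : A → WQSym n) → ∀ w → ∑ xs f w ≡ sumOver xs (λ x → f x w)
  ∑-apply []       f w = refl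
  ∑-apply (x ∷ xs) f w = cong (f x w +_) (∑-apply xs f w)

  N-⟦⟧ : (u v : PackedWord n) → N u v ≡ ⟦ u ≟ᴾ v ⟧
  N-⟦⟧ u v with u ≟ᴾ v
  ... | yes _ = refl
  ... | no  _ = refl

  sift-N : (u : PackedWord n) (f : PackedWord n → ℕ) →
           sumOver (packedWords n) (λ v → N u v * f v) ≡ f u
  sift-N {n} u f = trans
    (sumOver-cong (packedWords n) λ {v} _ → cong (_* f v) (N-⟦⟧ u v))
    (sumOver-sift (u ≟ᴾ_) (packedWords-unique n) (∈-packedWords u) (mk⇔ sym sym) f)

  N-∗ : (u : PackedWord n) (g : WQSym n) → ∀ w →
    (N u ∗ g) w ≡ sumOver (packedWords n) (λ v → g v * N (packBiword (Vec.zip (word u) (word v))) w)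
  N-∗ {n} u g w = begin
    (N u ∗ g) w ≡⟨ ∑-apply (packedWords n) _ w ⟩
    sumOver (packedWords n) (λ u′ → ∑ (packedWords n) (λ v → (N u u′ * g v) • N (u′ ⊗ v)) w)
      ≡⟨ sumOver-cong (packedWords n) (λ {u′} _ → trans (∑-apply (packedWords n) _ w)
           (trans (sumOver-cong (packedWords n) λ {v} _ → ℕₚ.*-assoc (N u u′) (g v) (N (u′ ⊗ v) w))
                  (sumOver-*ˡ (packedWords n) (N u u′) _))) ⟩
    sumOver (packedWords n) (λ u′ → N u u′ * sumOver (packedWords n) (λ v → g v * N (u′ ⊗ v) w))
      ≡⟨ sift-N u (λ u′ → sumOver (packedWords n) (λ v → g v * N (u′ ⊗ v) w)) ⟩
    sumOver (packedWords n) (λ v → g v * N (u ⊗ v) w) ∎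
    where
    open ≡-Reasoning
    _⊗_ : PackedWord n → PackedWord n → PackedWord n
    u ⊗ v = packBiword (Vec.zip (word u) (word v))

  ∑-N-coefficient : (f : PackedWord n → ℕ) → ∀ w → ∑ (packedWords n) (λ v → f v • N v) w ≡ f w
  ∑-N-coefficient {n} f w = trans (∑-apply (packedWords n) _ w) (trans
    (sumOver-cong (packedWords n) λ {v} _ → trans (ℕₚ.*-comm (f v) (N v w)) (cong (_* f v) (N-⟦⟧ v w)))
    (sumOver-sift (_≟ᴾ w) (packedWords-unique n) (∈-packedWords w) (mk⇔ (λ eq → eq) (λ eq → eq)) f))

  σ : ℕ → (n : ℕ) → WQSym n
  σ q n = ∑ (packedWords n) λ v → (q C max v) • N v

  -- σ q n is the sum of N (pack x) over the words x of length n in q letters.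
  N-∗-σ-count : ∀ q (u w : PackedWord n) →
    (N u ∗ σ q n) w ≡ sumOver (wordsOver (upTo q) n) (λ x → ⟦ packBiword (Vec.zip (word u) x) ≟ᴾ w ⟧)
  N-∗-σ-count {n} q u w = begin
    (N u ∗ σ q n) w ≡⟨ N-∗ u (σ q n) w ⟩
    sumOver (packedWords n) (λ v → σ q n v * N (u ⊗ word v) w)
      ≡⟨ sumOver-cong (packedWords n) (λ {v} _ → cong (_* N (u ⊗ word v) w)
           (trans (∑-N-coefficient (λ v → q C max v) v) (sym (count-packings q v)))) ⟩
    sumOver (packedWords n) (λ v → sumOver words (λ x → ⟦ packℕ x ≟ᴾ v ⟧) * N (u ⊗ word v) w)
      ≡⟨ sumOver-cong (packedWords n) (λ {v} _ → sym (sumOver-*ʳ words (N (u ⊗ word v) w) _)) ⟩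
    sumOver (packedWords n) (λ v → sumOver words (λ x → ⟦ packℕ x ≟ᴾ v ⟧ * N (u ⊗ word v) w))
      ≡⟨ sumOver-swap (packedWords n) words _ ⟩
    sumOver words (λ x → sumOver (packedWords n) (λ v → ⟦ packℕ x ≟ᴾ v ⟧ * N (u ⊗ word v) w))
      ≡⟨ sumOver-cong words (λ {x} _ → sumOver-sift (packℕ x ≟ᴾ_) (packedWords-unique n)
           (∈-packedWords (packℕ x)) (mk⇔ sym sym) (λ v → N (u ⊗ word v) w)) ⟩
    sumOver words (λ x → N (u ⊗ word (packℕ x)) w)
      ≡⟨ sumOver-cong words (λ {x} _ → trans (cong (λ v → N v w) (packBiword-packℕ (word u) x))
           (N-⟦⟧ (u ⊗ x) w)) ⟩
    sumOver words (λ x → ⟦ (u ⊗ x) ≟ᴾ w ⟧) ∎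
    where
    open ≡-Reasoning
    words = wordsOver (upTo q) n
    _⊗_ : PackedWord n → Vec ℕ n → PackedWord n
    u ⊗ x = packBiword (Vec.zip (word u) x)

  N-∗-σ : ∀ q (u : PackedWord n) → N u ∗ σ q n ≋
    ∑ (finerWords u) (λ w → product (range (max u)) (λ i → q C max (block u w i)) • N w)
  N-∗-σ {n} q u w = trans (N-∗-σ-count q u w) (trans (count≡ (w finerThan? u)) (sym rhs≡))
    where
    f : PackedWord n → ℕ
    f w = product (range (max u)) (λ i → q C max (block u w i))
    rhs≡ : ∑ (finerWords u) (λ w → f w • N w) w ≡ ⟦ w finerThan? u ⟧ * f w
    rhs≡ = begin
      ∑ (finerWords u) (λ w → f w • N w) w           ≡⟨ ∑-apply (finerWords u) _ w ⟩
      sumOver (finerWords u) (λ w′ → f w′ * N w′ w)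
        ≡⟨ sumOver-filter (_finerThan? u) (packedWords n) _ ⟩
      sumOver (packedWords n) (λ w′ → ⟦ w′ finerThan? u ⟧ * (f w′ * N w′ w))
        ≡⟨ sumOver-cong (packedWords n) (λ {w′} _ → sym (ℕₚ.*-assoc ⟦ w′ finerThan? u ⟧ (f w′) (N w′ w))) ⟩
      sumOver (packedWords n) (λ w′ → ⟦ w′ finerThan? u ⟧ * f w′ * N w′ w)
        ≡⟨ ∑-apply (packedWords n) _ w ⟨
      ∑ (packedWords n) (λ w′ → (⟦ w′ finerThan? u ⟧ * f w′) • N w′) w
        ≡⟨ ∑-N-coefficient (λ w′ → ⟦ w′ finerThan? u ⟧ * f w′) w ⟩
      ⟦ w finerThan? u ⟧ * f w ∎
      where open ≡-Reasoning
    count≡ : (finer? : Dec (w finerThan u)) →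
      sumOver (wordsOver (upTo q) n) (λ x → ⟦ packBiword (Vec.zip (word u) x) ≟ᴾ w ⟧) ≡ ⟦ finer? ⟧ * f w
    count≡ (yes finer) = trans (count-biword-packings q u w finer) (sym (ℕₚ.*-identityˡ (f w)))
    count≡ (no ¬finer) = sumOver-zero (wordsOver (upTo q) n) λ {x} _ →
      ⟦⟧-no (packBiword (Vec.zip (word u) x) ≟ᴾ w) (¬finer ∘ packBiword-finer u w x)

-- A relation is used instead of a homomorphism because a polynomial and a count are compared only
-- after both are mapped into K. Closure under 0, 1, sums and products suffices, since the
-- expressions in question are built from these alone.
module Transfer {a₁ ℓ₁ a₂ ℓ₂ ℓ} (R₁ : RawRing a₁ ℓ₁) (R₂ : RawRing a₂ ℓ₂)
  (_∼_ : RawRing.Carrier R₁ → RawRing.Carrier R₂ → Set ℓ)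
  (0∼0 : RawRing.0# R₁ ∼ RawRing.0# R₂) (1∼1 : RawRing.1# R₁ ∼ RawRing.1# R₂)
  (+-resp : ∀ {x y x′ y′} → x ∼ x′ → y ∼ y′ → RawRing._+_ R₁ x y ∼ RawRing._+_ R₂ x′ y′)
  (*-resp : ∀ {x y x′ y′} → x ∼ x′ → y ∼ y′ → RawRing._*_ R₁ x y ∼ RawRing._*_ R₂ x′ y′)
  where
  private
    module R₁ = RawRing R₁
    module R₂ = RawRing R₂
  module W₁ = WQSym* R₁
  module W₂ = WQSym* R₂

  ∑-resp : (xs : List A) {f : A → W₁.WQSym n} {g : A → W₂.WQSym n} {w : PackedWord n} →
           (∀ x → f x w ∼ g x w) → W₁.∑ xs f w ∼ W₂.∑ xs g w
  ∑-resp []       f∼g = 0∼0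
  ∑-resp (x ∷ xs) f∼g = +-resp (f∼g x) (∑-resp xs f∼g)

  product-resp : (xs : List A) (f : A → R₁.Carrier) (g : A → R₂.Carrier) →
                 (∀ x → f x ∼ g x) → W₁.product xs f ∼ W₂.product xs g
  product-resp []       f g f∼g = 1∼1
  product-resp (x ∷ xs) f g f∼g = *-resp (f∼g x) (product-resp xs f g f∼g)

  N-resp : (u v : PackedWord n) → W₁.N u v ∼ W₂.N u v
  N-resp u v with u ≟ᴾ v
  ... | yes _ = 1∼1
  ... | no  _ = 0∼0

  ∗-resp : (f₁ g₁ : W₁.WQSym n) (f₂ g₂ : W₂.WQSym n) → (∀ v → f₁ v ∼ f₂ v) → (∀ v → g₁ v ∼ g₂ v) →
           ∀ w → (f₁ W₁.∗ g₁) w ∼ (f₂ W₂.∗ g₂) w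
  ∗-resp {n} f₁ g₁ f₂ g₂ f∼ g∼ w = ∑-resp (packedWords n) λ u → ∑-resp (packedWords n) λ v →
    *-resp (*-resp (f∼ u) (g∼ v)) (N-resp (packBiword (Vec.zip (word u) (word v))) w)

k>n⇒nP′k≡0 : ∀ {n k} → n < k → n P′ k ≡ 0
k>n⇒nP′k≡0 {n} {suc k} (s≤s n≤k) with ℕₚ.m≤n⇒m<n∨m≡n n≤k
... | inj₁ n<k  = trans (cong ((n ∸ k) *_) (k>n⇒nP′k≡0 n<k)) (ℕₚ.*-zeroʳ (n ∸ k))
... | inj₂ refl = cong (_* (n P′ n)) (ℕₚ.n∸n≡0 n)

-- `n P′ k` is the falling factorial with truncated factors, whose recursion matches that of
-- `fallingFactorial`. For k > n both sides vanish, the right one because of the factor `n ∸ n`.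
k!*nCk≡nP′k : ∀ n k → k ! * (n C k) ≡ n P′ k
k!*nCk≡nP′k n k with k ℕₚ.≤? n
... | no k≰n = trans (cong (k ! *_) (k>n⇒nCk≡0 (ℕₚ.≰⇒> k≰n)))
                 (trans (ℕₚ.*-zeroʳ (k !)) (sym (k>n⇒nP′k≡0 (ℕₚ.≰⇒> k≰n))))
... | yes k≤n = begin
  k ! * (n C k)                        ≡⟨ ℕₚ.*-comm (k !) (n C k) ⟩
  (n C k) * k !                        ≡⟨ cong (_* k !) (nCk≡nPk/k! k≤n) ⟩
  ((n P k) / k !) {{k !≢0}} * k !   ≡⟨ m/n*n≡m {{k !≢0}} (subst (k ! ∣_) (sym nPk≡nP′k) (k!∣nP′k k≤n)) ⟩
  n P k                                ≡⟨ nPk≡nP′k ⟩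
  n P′ k                               ∎
  where
  open ≡-Reasoning
  nPk≡nP′k : n P k ≡ n P′ k
  nPk≡nP′k with k ≤ᵇ n | ℕₚ.≤⇒≤ᵇ k≤n
  ... | true | _ = refl

-- Polynomials over a commutative ring

module PolynomialProperties {c ℓ} (R : CommutativeRing c ℓ) where
  open CommutativeRing R renaming (_+_ to _+ᴿ_; _*_ to _*ᴿ_; refl to ≈-refl; sym to ≈-sym; trans to ≈-trans)
  open Polynomial rawRing
  open Solver commutativeSemiring using (solve; _:=_; _:+_; _:*_; con)
  open SetoidReasoning setoid
  open RingProperties ring using (-‿distribʳ-*; -0#≈0#)
  open GroupProperties +-group using (x∙y⁻¹≈ε⇒x≈y)
  open AbelianGroupProperties +-abelianGroup using (⁻¹-∙-comm)
  open SemiringMult semiring using (×-homo-+) renaming (_×_ to _·_)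

  -- Coefficients

  coeff-+ : ∀ p q k → coeff (p +ᴾ q) k ≈ coeff p k +ᴿ coeff q k
  coeff-+ []      q       k       = ≈-sym (+-identityˡ _)
  coeff-+ (a ∷ p) []      k       = ≈-sym (+-identityʳ _)
  coeff-+ (a ∷ p) (b ∷ q) zero    = ≈-refl
  coeff-+ (a ∷ p) (b ∷ q) (suc k) = coeff-+ p q k

  coeff-neg : ∀ p k → coeff (map (-_) p) k ≈ - coeff p k
  coeff-neg []      k       = ≈-sym -0#≈0#
  coeff-neg (a ∷ p) zero    = ≈-refl
  coeff-neg (a ∷ p) (suc k) = coeff-neg p k

  coeff-scale : ∀ a p k → coeff (map (a *ᴿ_) p) k ≈ a *ᴿ coeff p k
  coeff-scale a []      k       = ≈-sym (zeroʳ a)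
  coeff-scale a (b ∷ p) zero    = ≈-refl
  coeff-scale a (b ∷ p) (suc k) = coeff-scale a p k

  coeff-constant* : ∀ a p k → coeff (constant a *ᴾ p) k ≈ a *ᴿ coeff p k
  coeff-constant* a p k = begin
    coeff (map (a *ᴿ_) p +ᴾ constant 0#) k        ≈⟨ coeff-+ (map (a *ᴿ_) p) (constant 0#) k ⟩
    coeff (map (a *ᴿ_) p) k +ᴿ coeff (constant 0#) k ≈⟨ +-cong (coeff-scale a p k) (coeff-0 k) ⟩
    a *ᴿ coeff p k +ᴿ 0#                          ≈⟨ +-identityʳ _ ⟩
    a *ᴿ coeff p k                                ∎
    where
    coeff-0 : ∀ k → coeff (constant 0#) k ≈ 0#
    coeff-0 zero    = ≈-refl
    coeff-0 (suc k) = ≈-refl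

  coeff-*linear-zero : ∀ p a b → coeff (p *ᴾ (a ∷ b ∷ [])) 0 ≈ coeff p 0 *ᴿ a
  coeff-*linear-zero []      a b = ≈-sym (zeroˡ a)
  coeff-*linear-zero (d ∷ p) a b = +-identityʳ _

  -- Each factor t - m of a falling factorial reduces to such a list of two coefficients, with b
  -- equal to `1#`.
  coeff-*linear-suc : ∀ p a b k →
    coeff (p *ᴾ (a ∷ b ∷ [])) (suc k) ≈ coeff p (suc k) *ᴿ a +ᴿ coeff p k *ᴿ b
  coeff-*linear-suc []      a b k       = solve 2 (λ a b → con 0 := con 0 :* a :+ con 0 :* b) ≈-refl a b
  coeff-*linear-suc (d ∷ p) a b zero    =
    ≈-trans (coeff-+ (constant (d *ᴿ b)) (p *ᴾ (a ∷ b ∷ [])) 0)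
      (≈-trans (+-congˡ (coeff-*linear-zero p a b)) (+-comm _ _))
  coeff-*linear-suc (d ∷ p) a b (suc k) =
    ≈-trans (coeff-+ (constant (d *ᴿ b)) (p *ᴾ (a ∷ b ∷ [])) (suc k))
      (≈-trans (+-identityˡ _) (coeff-*linear-suc p a b k))

  coeff-*constant : ∀ p a k → coeff (p *ᴾ constant a) k ≈ coeff p k *ᴿ a
  coeff-*constant []      a k       = ≈-sym (zeroˡ a)
  coeff-*constant (d ∷ p) a zero    = +-identityʳ _
  coeff-*constant (d ∷ p) a (suc k) = coeff-*constant p a k

  coeff-*[] : ∀ p k → coeff (p *ᴾ []) k ≈ 0#
  coeff-*[] []      k       = ≈-refl
  coeff-*[] (d ∷ p) zero    = ≈-refl
  coeff-*[] (d ∷ p) (suc k) = coeff-*[] p k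

  coeff-t*-zero : ∀ p → coeff (t *ᴾ p) 0 ≈ 0#
  coeff-t*-zero p = begin
    coeff (t *ᴾ p) 0                  ≈⟨ coeff-+ (map (0# *ᴿ_) p) _ 0 ⟩
    coeff (map (0# *ᴿ_) p) 0 +ᴿ 0#    ≈⟨ +-identityʳ _ ⟩
    coeff (map (0# *ᴿ_) p) 0          ≈⟨ coeff-scale 0# p 0 ⟩
    0# *ᴿ coeff p 0                   ≈⟨ zeroˡ _ ⟩
    0#                                ∎

  coeff-t*-suc : ∀ p k → coeff (t *ᴾ p) (suc k) ≈ coeff p k
  coeff-t*-suc p k = begin
    coeff (t *ᴾ p) (suc k) ≈⟨ coeff-+ (map (0# *ᴿ_) p) _ (suc k) ⟩
    coeff (map (0# *ᴿ_) p) (suc k) +ᴿ coeff (constant 1# *ᴾ p) k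
      ≈⟨ +-cong (coeff-scale 0# p (suc k)) (coeff-constant* 1# p k) ⟩
    0# *ᴿ coeff p (suc k) +ᴿ 1# *ᴿ coeff p k
      ≈⟨ solve 2 (λ a b → con 0 :* a :+ con 1 :* b := b) ≈-refl (coeff p (suc k)) (coeff p k) ⟩
    coeff p k ∎

  -- Evaluation

  eval : Poly → Carrier → Carrier
  eval []      x = 0#
  eval (a ∷ p) x = a +ᴿ x *ᴿ eval p x

  eval-cong : ∀ p {x y} → x ≈ y → eval p x ≈ eval p y
  eval-cong []      x≈y = ≈-refl
  eval-cong (a ∷ p) x≈y = +-congˡ (*-cong x≈y (eval-cong p x≈y))

  eval-+ : ∀ p q x → eval (p +ᴾ q) x ≈ eval p x +ᴿ eval q x
  eval-+ []      q       x = ≈-sym (+-identityˡ _)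
  eval-+ (a ∷ p) []      x = ≈-sym (+-identityʳ _)
  eval-+ (a ∷ p) (b ∷ q) x = ≈-trans (+-congˡ (*-congˡ (eval-+ p q x)))
    (solve 5 (λ a b x y z → (a :+ b) :+ x :* (y :+ z) := (a :+ x :* y) :+ (b :+ x :* z)) ≈-refl
      a b x (eval p x) (eval q x))

  eval-scale : ∀ a p x → eval (map (a *ᴿ_) p) x ≈ a *ᴿ eval p x
  eval-scale a []      x = ≈-sym (zeroʳ a)
  eval-scale a (b ∷ p) x = ≈-trans (+-congˡ (*-congˡ (eval-scale a p x)))
    (solve 4 (λ a b x y → a :* b :+ x :* (a :* y) := a :* (b :+ x :* y)) ≈-refl a b x (eval p x))

  eval-* : ∀ p q x → eval (p *ᴾ q) x ≈ eval p x *ᴿ eval q x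
  eval-* []      q x = ≈-sym (zeroˡ _)
  eval-* (a ∷ p) q x = begin
    eval (map (a *ᴿ_) q +ᴾ (0# ∷ (p *ᴾ q))) x ≈⟨ eval-+ (map (a *ᴿ_) q) _ x ⟩
    eval (map (a *ᴿ_) q) x +ᴿ (0# +ᴿ x *ᴿ eval (p *ᴾ q) x)
      ≈⟨ +-cong (eval-scale a q x) (+-congˡ (*-congˡ (eval-* p q x))) ⟩
    a *ᴿ eval q x +ᴿ (0# +ᴿ x *ᴿ (eval p x *ᴿ eval q x))
      ≈⟨ solve 4 (λ a x y z → a :* z :+ (con 0 :+ x :* (y :* z)) := (a :+ x :* y) :* z) ≈-refl
           a x (eval p x) (eval q x) ⟩
    (a +ᴿ x *ᴿ eval p x) *ᴿ eval q x ∎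

  eval-neg : ∀ p x → eval (map (-_) p) x ≈ - eval p x
  eval-neg []      x = ≈-sym -0#≈0#
  eval-neg (a ∷ p) x = begin
    - a +ᴿ x *ᴿ eval (map (-_) p) x ≈⟨ +-congˡ (*-congˡ (eval-neg p x)) ⟩
    - a +ᴿ x *ᴿ - eval p x          ≈⟨ +-congˡ (-‿distribʳ-* x (eval p x)) ⟨
    - a +ᴿ - (x *ᴿ eval p x)        ≈⟨ ⁻¹-∙-comm a _ ⟩
    - (a +ᴿ x *ᴿ eval p x)          ∎

  eval-constant : ∀ a x → eval (constant a) x ≈ a
  eval-constant = solve 2 (λ a x → a :+ x :* con 0 := a) ≈-refl

  -- Horner's scheme: the values at a of the suffixes of p are the coefficients of the
  -- quotient of t p - a p(a) by t - a.
  suffixValues : Carrier → Poly → Poly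
  suffixValues a []      = []
  suffixValues a (b ∷ p) = eval (b ∷ p) a ∷ suffixValues a p

  -- The division identity x p(x) = a p(a) + (x - a) q(x), with x written as a + d: without
  -- subtraction it is a semiring identity at each step of the induction.
  eval-suffixValues : ∀ p a d →
    (a +ᴿ d) *ᴿ eval p (a +ᴿ d) ≈ a *ᴿ eval p a +ᴿ d *ᴿ eval (suffixValues a p) (a +ᴿ d)
  eval-suffixValues []      a d =
    solve 2 (λ a d → (a :+ d) :* con 0 := a :* con 0 :+ d :* con 0) ≈-refl a d
  eval-suffixValues (b ∷ p) a d = ≈-trans (*-congˡ (+-congˡ (eval-suffixValues p a d)))
    (solve 5 (λ b e a d q → (a :+ d) :* (b :+ (a :* e :+ d :* q)) :=
                            a :* (b :+ a :* e) :+ d :* ((b :+ a :* e) :+ (a :+ d) :* q)) ≈-refl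
      b (eval p a) a d (eval (suffixValues a p) (a +ᴿ d)))

  eval≈coeff-suffixValues : ∀ a p → eval p a ≈ coeff (suffixValues a p) 0
  eval≈coeff-suffixValues a []      = ≈-refl
  eval≈coeff-suffixValues a (b ∷ p) = ≈-refl

  -- Each coefficient of p is a suffix value minus a times the next one.
  suffixValues-zero : ∀ a p → (∀ k → coeff (suffixValues a p) k ≈ 0#) → ∀ k → coeff p k ≈ 0#
  suffixValues-zero a []      q≈0 k       = ≈-refl
  suffixValues-zero a (b ∷ p) q≈0 (suc k) = suffixValues-zero a p (λ j → q≈0 (suc j)) k
  suffixValues-zero a (b ∷ p) q≈0 zero    = begin
    b                 ≈⟨ solve 2 (λ b a → b := b :+ a :* con 0) ≈-refl b a ⟩
    b +ᴿ a *ᴿ 0#      ≈⟨ +-congˡ (*-congˡ (≈-trans (eval≈coeff-suffixValues a p) (q≈0 1))) ⟨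
    b +ᴿ a *ᴿ eval p a ≈⟨ q≈0 0 ⟩
    0#                ∎

  length-suffixValues : ∀ a p → length (suffixValues a p) ≡ length p
  length-suffixValues a []      = refl
  length-suffixValues a (b ∷ p) = cong suc (length-suffixValues a p)

  -- Polynomials vanishing at all sufficiently large natural numbers

  module _ (inverse : ∀ n → .{{NonZero n}} → ∃ λ y → y *ᴿ (n · 1#) ≈ 1#) where

    -- Dividing b + t p by t - s leaves `suffixValues a p`, which is shorter and vanishes at s + 1,
    -- s + 2, ..., because the difference m + 1 of s + 1 + m and s is invertible. The shift s
    -- records which roots are used up; the bound d makes the recursion structural.
    roots⇒zero : ∀ d p s → length p ≤ d → (∀ m → eval p ((s + m) · 1#) ≈ 0#) → ∀ k → coeff p k ≈ 0#
    roots⇒zero d       []      s _          roots k = ≈-refl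
    roots⇒zero (suc d) (b ∷ p) s (s≤s len≤d) roots = coeffs
      where
      a = s · 1#
      root-a : b +ᴿ a *ᴿ eval p a ≈ 0#
      root-a = subst (λ m → eval (b ∷ p) (m · 1#) ≈ 0#) (ℕₚ.+-identityʳ s) (roots 0)

      quotient-roots : ∀ m → eval (suffixValues a p) ((suc s + m) · 1#) ≈ 0#
      quotient-roots m = begin
        e                    ≈⟨ *-identityˡ e ⟨
        1# *ᴿ e              ≈⟨ *-congʳ (proj₂ (inverse (suc m))) ⟨
        y *ᴿ δ *ᴿ e          ≈⟨ *-assoc y δ e ⟩
        y *ᴿ (δ *ᴿ e)        ≈⟨ *-congˡ δe≈0 ⟩
        y *ᴿ 0#              ≈⟨ zeroʳ y ⟩
        0#                   ∎
        where
        y = proj₁ (inverse (suc m))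
        δ = suc m · 1#
        x = (suc s + m) · 1#
        e = eval (suffixValues a p) x
        x≈a+δ : x ≈ a +ᴿ δ
        x≈a+δ = ≈-trans (reflexive (cong (_· 1#) (sym (ℕₚ.+-suc s m)))) (×-homo-+ 1# s (suc m))
        δe≈0 : δ *ᴿ e ≈ 0#
        δe≈0 = begin
          δ *ᴿ e                                 ≈⟨ +-identityˡ _ ⟨
          0# +ᴿ δ *ᴿ e                           ≈⟨ +-cong (≈-sym root-a) (*-congˡ (eval-cong (suffixValues a p) x≈a+δ)) ⟩
          b +ᴿ a *ᴿ eval p a +ᴿ δ *ᴿ eval (suffixValues a p) (a +ᴿ δ) ≈⟨ +-assoc b _ _ ⟩
          b +ᴿ (a *ᴿ eval p a +ᴿ δ *ᴿ eval (suffixValues a p) (a +ᴿ δ))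
                                                 ≈⟨ +-congˡ (eval-suffixValues p a δ) ⟨
          eval (b ∷ p) (a +ᴿ δ)                  ≈⟨ eval-cong (b ∷ p) x≈a+δ ⟨
          eval (b ∷ p) x                         ≈⟨ reflexive (cong (λ m → eval (b ∷ p) (m · 1#)) (sym (ℕₚ.+-suc s m))) ⟩
          eval (b ∷ p) ((s + suc m) · 1#)        ≈⟨ roots (suc m) ⟩
          0#                                     ∎

      quotient-zero : ∀ k → coeff (suffixValues a p) k ≈ 0#
      quotient-zero = roots⇒zero d (suffixValues a p) (suc s)
        (subst (_≤ d) (sym (length-suffixValues a p)) len≤d) quotient-roots

      coeffs : ∀ k → coeff (b ∷ p) k ≈ 0#
      coeffs (suc k) = suffixValues-zero a p quotient-zero k
      -- p(a) is the leading suffix value, hence zero, so the root at a leaves b = 0.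
      coeffs zero    = begin
        b                  ≈⟨ solve 2 (λ b a → b := b :+ a :* con 0) ≈-refl b a ⟩
        b +ᴿ a *ᴿ 0#       ≈⟨ +-congˡ (*-congˡ (≈-trans (eval≈coeff-suffixValues a p) (quotient-zero 0))) ⟨
        b +ᴿ a *ᴿ eval p a ≈⟨ root-a ⟩
        0#                 ∎

    eval-injective : ∀ p q → (∀ m → eval p (m · 1#) ≈ eval q (m · 1#)) → ∀ k → coeff p k ≈ coeff q k
    eval-injective p q p≗q k = x∙y⁻¹≈ε⇒x≈y _ _ (begin
      coeff p k +ᴿ - coeff q k            ≈⟨ +-congˡ (coeff-neg q k) ⟨
      coeff p k +ᴿ coeff (map (-_) q) k   ≈⟨ coeff-+ p (map (-_) q) k ⟨
      coeff (p +ᴾ map (-_) q) k           ≈⟨ roots⇒zero _ (p +ᴾ map (-_) q) 0 ℕₚ.≤-refl difference-zero k ⟩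
      0#                                  ∎)
      where
      difference-zero : ∀ m → eval (p +ᴾ map (-_) q) (m · 1#) ≈ 0#
      difference-zero m = begin
        eval (p +ᴾ map (-_) q) (m · 1#)                   ≈⟨ eval-+ p (map (-_) q) _ ⟩
        eval p (m · 1#) +ᴿ eval (map (-_) q) (m · 1#)     ≈⟨ +-cong (p≗q m) (eval-neg q _) ⟩
        eval q (m · 1#) +ᴿ - eval q (m · 1#)              ≈⟨ -‿inverseʳ _ ⟩
        0#                                                ∎

-- The two expansions over the field K

module EulerianProperties {c ℓ₁ ℓ₂} (K : HeytingField c ℓ₁ ℓ₂) (char0 : CharacteristicZero K) where
  open Eulerian K char0

  commutativeRing : CommutativeRing c ℓ₁
  commutativeRing = HeytingCommutativeRing.commutativeRing (HeytingField.heytingCommutativeRing K)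

  open CommutativeRing commutativeRing hiding (zero)
    renaming (_+_ to _+ᴷ_; _*_ to _*ᴷ_; refl to ≈-refl; sym to ≈-sym; trans to ≈-trans)
  open Polynomial rawRing using (_+ᴾ_; _*ᴾ_)
  open PolynomialProperties commutativeRing
  open Solver commutativeSemiring using (solve; _:=_; _:+_; _:*_; con)
  open SetoidReasoning setoid
  open RingProperties ring using (-0#≈0#)
  open SemiringMult semiring using (×-homo-+; ×1-homo-*; ×-congˡ) renaming (_×_ to _·_)

  1/-inverse : ∀ n .{{_ : NonZero n}} → (1/ n) *ᴷ (n · 1#) ≈ 1#
  1/-inverse n = begin
    (1/ n) *ᴷ (n · 1#)             ≈⟨ *-congˡ (+-identityʳ (n · 1#)) ⟨
    (1/ n) *ᴷ (n · 1# +ᴷ 0#)       ≈⟨ *-congˡ (+-congˡ -0#≈0#) ⟨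
    (1/ n) *ᴷ (n · 1# +ᴷ - 0#)     ≈⟨ proj₁ (proj₂ (HeytingField.#⇒invertible K (char0 n))) ⟩
    1#                             ∎

  -- Values at natural numbers

  module _ (q : ℕ) where

    x : Carrier
    x = q · 1#

    eval-factor : ∀ m → m ≤ q → eval (t K[t].+ K[t].- constant (m · 1#)) x ≈ (q ∸ m) · 1#
    eval-factor m m≤q = begin
      (0# +ᴷ - (m · 1#)) +ᴷ x *ᴷ (1# +ᴷ x *ᴷ 0#)
        ≈⟨ solve 2 (λ n x → (con 0 :+ n) :+ x :* (con 1 :+ x :* con 0) := x :+ n) ≈-refl (- (m · 1#)) x ⟩
      x +ᴷ - (m · 1#)
        ≈⟨ +-congʳ (≈-trans (reflexive (cong (_· 1#) (sym (ℕₚ.m∸n+n≡m m≤q)))) (×-homo-+ 1# (q ∸ m) m)) ⟩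
      ((q ∸ m) · 1# +ᴷ m · 1#) +ᴷ - (m · 1#) ≈⟨ +-assoc _ _ _ ⟩
      (q ∸ m) · 1# +ᴷ (m · 1# +ᴷ - (m · 1#)) ≈⟨ +-congˡ (-‿inverseʳ (m · 1#)) ⟩
      (q ∸ m) · 1# +ᴷ 0#                     ≈⟨ +-identityʳ _ ⟩
      (q ∸ m) · 1#                           ∎

    eval-fallingFactorial : ∀ m → eval (fallingFactorial m) x ≈ (q P′ m) · 1#
    eval-fallingFactorial zero    = ≈-trans (eval-constant 1# x) (≈-sym (+-identityʳ 1#))
    eval-fallingFactorial (suc m) = begin
      eval (fallingFactorial m *ᴾ factor) x            ≈⟨ eval-* (fallingFactorial m) factor x ⟩
      eval (fallingFactorial m) x *ᴷ eval factor x     ≈⟨ *-congʳ (eval-fallingFactorial m) ⟩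
      (q P′ m) · 1# *ᴷ eval factor x                   ≈⟨ step (m ℕₚ.≤? q) ⟩
      (q P′ m) · 1# *ᴷ (q ∸ m) · 1#                    ≈⟨ *-comm _ _ ⟩
      (q ∸ m) · 1# *ᴷ (q P′ m) · 1#                    ≈⟨ ×1-homo-* (q ∸ m) (q P′ m) ⟨
      ((q ∸ m) * (q P′ m)) · 1#                        ∎
      where
      factor = t K[t].+ K[t].- constant (m · 1#)
      step : Dec (m ≤ q) → (q P′ m) · 1# *ᴷ eval factor x ≈ (q P′ m) · 1# *ᴷ (q ∸ m) · 1#
      step (yes m≤q) = *-congˡ (eval-factor m m≤q)
      -- For m > q the factor q - m differs from the truncated `q ∸ m`, but the product of the
      -- preceding factors is already zero.
      step (no  m≰q) = ≈-trans (vanishes (eval factor x)) (≈-sym (vanishes ((q ∸ m) · 1#)))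
        where
        vanishes : ∀ y → (q P′ m) · 1# *ᴷ y ≈ 0#
        vanishes y = ≈-trans (*-congʳ (×-congˡ (k>n⇒nP′k≡0 (ℕₚ.≰⇒> m≰q)))) (zeroˡ y)

    eval-binomial : ∀ m → eval (binomial m) x ≈ (q C m) · 1#
    eval-binomial m = begin
      eval (constant 1/m! *ᴾ fallingFactorial m) x   ≈⟨ eval-* (constant 1/m!) (fallingFactorial m) x ⟩
      eval (constant 1/m!) x *ᴷ eval (fallingFactorial m) x
        ≈⟨ *-cong (eval-constant 1/m! x) (eval-fallingFactorial m) ⟩
      1/m! *ᴷ (q P′ m) · 1#                ≈⟨ *-congˡ (×-congˡ (sym (k!*nCk≡nP′k q m))) ⟩
      1/m! *ᴷ (m ! * (q C m)) · 1#         ≈⟨ *-congˡ (×1-homo-* (m !) (q C m)) ⟩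
      1/m! *ᴷ ((m !) · 1# *ᴷ (q C m) · 1#) ≈⟨ *-assoc _ _ _ ⟨
      1/m! *ᴷ (m !) · 1# *ᴷ (q C m) · 1#   ≈⟨ *-congʳ (1/-inverse (m !) {{m !≢0}}) ⟩
      1# *ᴷ (q C m) · 1#                   ≈⟨ *-identityˡ _ ⟩
      (q C m) · 1#                         ∎
      where 1/m! = (1/ (m !)) {{m !≢0}}

    -- Wrapped in a record so that `p` and `a` stay visible to unification as parameters of the
    -- type.
    record _HasValue_ (p : Poly) (a : ℕ) : Set ℓ₁ where
      constructor hasValue
      field value : eval p x ≈ a · 1#

    HasValue-+ : ∀ {p p′ a a′} → p HasValue a → p′ HasValue a′ → (p +ᴾ p′) HasValue (a + a′)
    HasValue-+ {p} {p′} {a} {a′} (hasValue p∼a) (hasValue p′∼a′) = hasValue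
      (≈-trans (eval-+ p p′ x) (≈-trans (+-cong p∼a p′∼a′) (≈-sym (×-homo-+ 1# a a′))))

    HasValue-* : ∀ {p p′ a a′} → p HasValue a → p′ HasValue a′ → (p *ᴾ p′) HasValue (a * a′)
    HasValue-* {p} {p′} {a} {a′} (hasValue p∼a) (hasValue p′∼a′) = hasValue
      (≈-trans (eval-* p p′ x) (≈-trans (*-cong p∼a p′∼a′) (≈-sym (×1-homo-* a a′))))

    open Transfer rawRing[t] ℕ-rawRing _HasValue_ (hasValue ≈-refl)
      (hasValue (≈-trans (eval-constant 1# x) (≈-sym (+-identityʳ 1#)))) HasValue-+ HasValue-*

    N-∗-σᵗ-value : (u w : PackedWord n) →
      (Over-K[t].N u Over-K[t].∗ σᵗ n) w HasValue (Over-ℕ.N u Over-ℕ.∗ σ q n) w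
    N-∗-σᵗ-value {n} u w = ∗-resp (Over-K[t].N u) (σᵗ n) (Over-ℕ.N u) (σ q n) (N-resp u)
      (λ v → ∑-resp (packedWords n) λ v′ → HasValue-* {binomial (max v′)} {_} {q C max v′}
        (hasValue (eval-binomial (max v′))) (N-resp v′ v)) w

    finerExpansion-value : (u w : PackedWord n) →
      Over-K[t].∑ (finerWords u) (λ w → Over-K[t].product (range (max u)) (λ i → binomial (max (block u w i)))
        Over-K[t].• Over-K[t].N w) w HasValue
      Over-ℕ.∑ (finerWords u) (λ w → Over-ℕ.product (range (max u)) (λ i → q C max (block u w i))
        Over-ℕ.• Over-ℕ.N w) w
    finerExpansion-value u w = ∑-resp (finerWords u) λ w′ →
      let p = λ i → binomial (max (block u w′ i))
          c = λ i → q C max (block u w′ i)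
      in HasValue-* {Over-K[t].product (range (max u)) p} {_} {Over-ℕ.product (range (max u)) c}
           (product-resp (range (max u)) p c λ i → hasValue (eval-binomial (max (block u w′ i))))
           (N-resp w′ w)

  finer-expansion : (u : PackedWord n) → let open Over-K[t] in
    N u ∗ σᵗ n ≋ ∑ (finerWords u) (λ w → product (range (max u)) (λ i → binomial (max (block u w i))) • N w)
  finer-expansion u w = eval-injective (λ n → 1/ n , 1/-inverse n) V rhs λ q →
    ≈-trans (value (N-∗-σᵗ-value q u w))
      (≈-trans (×-congˡ (N-∗-σ q u w)) (≈-sym (value (finerExpansion-value q u w))))
    where
    open Over-K[t]
    open _HasValue_
    V = (N u ∗ σᵗ _) w
    rhs = ∑ (finerWords u) (λ w → product (range (max u)) (λ i → binomial (max (block u w i))) • N w) w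

  -- Coefficients of powers of t and the Eulerian expansion

  private
    module W  = Over-K
    module Wᵗ = Over-K[t]

  coeff-∑ : (xs : List A) (f : A → Wᵗ.WQSym n) (g : A → W.WQSym n) (w : PackedWord n) (k : ℕ) →
            (∀ a → coeff (f a w) k ≈ g a w) → coeff (Wᵗ.∑ xs f w) k ≈ W.∑ xs g w
  coeff-∑ []       f g w k f≈g = ≈-refl
  coeff-∑ (a ∷ xs) f g w k f≈g =
    ≈-trans (coeff-+ (f a w) (Wᵗ.∑ xs f w) k) (+-cong (f≈g a) (coeff-∑ xs f g w k f≈g))

  ∑-zero : (xs : List A) (g : A → W.WQSym n) (w : PackedWord n) → (∀ a → g a w ≈ 0#) → W.∑ xs g w ≈ 0#
  ∑-zero []       g w g≈0 = ≈-refl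
  ∑-zero (a ∷ xs) g w g≈0 = ≈-trans (+-cong (g≈0 a) (∑-zero xs g w g≈0)) (+-identityˡ 0#)

  coeff-*N : ∀ p (u v : PackedWord n) k → coeff (p *ᴾ Wᵗ.N u v) k ≈ coeff p k *ᴷ W.N u v
  coeff-*N p u v k with u ≟ᴾ v
  ... | yes _ = coeff-*constant p 1# k
  ... | no  _ = ≈-trans (coeff-*[] p k) (≈-sym (zeroʳ _))

  coeff-N* : ∀ p (u v : PackedWord n) k → coeff (Wᵗ.N u v *ᴾ p) k ≈ W.N u v *ᴷ coeff p k
  coeff-N* p u v k with u ≟ᴾ v
  ... | yes _ = coeff-constant* 1# p k
  ... | no  _ = ≈-sym (zeroˡ _)

  -- All coefficients of basis elements are 0 or 1, so `g` is only ever multiplied by constants, and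
  -- extracting a coefficient commutes with that.
  coeff-N∗ : (u : PackedWord n) (g : Wᵗ.WQSym n) → ∀ w k →
             coeff ((Wᵗ.N u Wᵗ.∗ g) w) k ≈ (W.N u W.∗ (λ v → coeff (g v) k)) w
  coeff-N∗ {n} u g w k =
    coeff-∑ (packedWords n) _ _ w k λ u′ → coeff-∑ (packedWords n) _ _ w k λ v →
      ≈-trans (coeff-*N (Wᵗ.N u u′ *ᴾ g v) (packBiword (Vec.zip (word u′) (word v))) w k)
              (*-congʳ (coeff-N* (g v) u u′ k))

  ∗-zeroʳ : (f g : W.WQSym n) → (∀ v → g v ≈ 0#) → ∀ w → (f W.∗ g) w ≈ 0#
  ∗-zeroʳ {n} f g g≈0 w = ∑-zero (packedWords n) _ w λ u → ∑-zero (packedWords n) _ w λ v →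
    ≈-trans (*-congʳ (≈-trans (*-congˡ (g≈0 v)) (zeroʳ (f u)))) (zeroˡ _)

  coeff-power-t-≡ : ∀ k → coeff (Wᵗ.power t k) k ≈ 1#
  coeff-power-t-≡ zero    = ≈-refl
  coeff-power-t-≡ (suc k) = ≈-trans (coeff-t*-suc (Wᵗ.power t k) k) (coeff-power-t-≡ k)

  coeff-power-t-≢ : ∀ k j → k ≢ j → coeff (Wᵗ.power t k) j ≈ 0#
  coeff-power-t-≢ zero    zero    k≢j = contradiction refl k≢j
  coeff-power-t-≢ zero    (suc j) k≢j = ≈-refl
  coeff-power-t-≢ (suc k) zero    k≢j = coeff-t*-zero (Wᵗ.power t k)
  coeff-power-t-≢ (suc k) (suc j) k≢j =
    ≈-trans (coeff-t*-suc (Wᵗ.power t k) j) (coeff-power-t-≢ k j (k≢j ∘ cong suc))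

  module _ (f : ℕ → W.WQSym n) (w : PackedWord n) (j : ℕ) where

    private
      term : ℕ → Wᵗ.WQSym n
      term k = Wᵗ.power t k Wᵗ.• extendScalars (f k)

    coeff-term-≢ : ∀ k → k ≢ j → coeff (term k w) j ≈ 0#
    coeff-term-≢ k k≢j = ≈-trans (coeff-*constant (Wᵗ.power t k) (f k w) j)
      (≈-trans (*-congʳ (coeff-power-t-≢ k j k≢j)) (zeroˡ _))

    coeff-∑-term-∉ : ∀ ks → ¬ j L.∈ ks → coeff (Wᵗ.∑ ks term w) j ≈ 0#
    coeff-∑-term-∉ []       j∉ = ≈-refl
    coeff-∑-term-∉ (k ∷ ks) j∉ = begin
      coeff (Wᵗ.∑ (k ∷ ks) term w) j                     ≈⟨ coeff-+ (term k w) (Wᵗ.∑ ks term w) j ⟩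
      coeff (term k w) j +ᴷ coeff (Wᵗ.∑ ks term w) j
        ≈⟨ +-cong (coeff-term-≢ k (λ { refl → j∉ (here refl) })) (coeff-∑-term-∉ ks (j∉ ∘ there)) ⟩
      0# +ᴷ 0#                                           ≈⟨ +-identityˡ 0# ⟩
      0#                                                 ∎

    coeff-∑-term-∈ : ∀ {ks} → Unique ks → j L.∈ ks → coeff (Wᵗ.∑ ks term w) j ≈ f j w
    coeff-∑-term-∈ {j ∷ ks} (j∉ks ∷ _) (here refl) = begin
      coeff (Wᵗ.∑ (j ∷ ks) term w) j                  ≈⟨ coeff-+ (term j w) (Wᵗ.∑ ks term w) j ⟩
      coeff (term j w) j +ᴷ coeff (Wᵗ.∑ ks term w) j
        ≈⟨ +-cong (coeff-*constant (Wᵗ.power t j) (f j w) j)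
                  (coeff-∑-term-∉ ks λ j∈ → All.lookup j∉ks j∈ refl) ⟩
      coeff (Wᵗ.power t j) j *ᴷ f j w +ᴷ 0#            ≈⟨ +-identityʳ _ ⟩
      coeff (Wᵗ.power t j) j *ᴷ f j w                 ≈⟨ *-congʳ (coeff-power-t-≡ j) ⟩
      1# *ᴷ f j w                                     ≈⟨ *-identityˡ _ ⟩
      f j w                                           ∎
    coeff-∑-term-∈ {k ∷ ks} (k∉ks ∷ ks!) (there j∈) = begin
      coeff (Wᵗ.∑ (k ∷ ks) term w) j                  ≈⟨ coeff-+ (term k w) (Wᵗ.∑ ks term w) j ⟩
      coeff (term k w) j +ᴷ coeff (Wᵗ.∑ ks term w) j
        ≈⟨ +-cong (coeff-term-≢ k (All.lookup k∉ks j∈)) (coeff-∑-term-∈ ks! j∈) ⟩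
      0# +ᴷ f j w                                     ≈⟨ +-identityˡ _ ⟩
      f j w                                           ∎

  -- The first factor is t - 0, whose constant term vanishes.
  coeff-fallingFactorial-zero : ∀ m → 1 ≤ m → coeff (fallingFactorial m) 0 ≈ 0#
  coeff-fallingFactorial-zero (suc zero) _ = begin
    coeff (fallingFactorial 1) 0 ≈⟨ coeff-*linear-zero (fallingFactorial 0) _ 1# ⟩
    1# *ᴷ (0# +ᴷ - 0#)           ≈⟨ ≈-trans (*-identityˡ _) (-‿inverseʳ 0#) ⟩
    0#                           ∎
  coeff-fallingFactorial-zero (suc (suc m)) _ = begin
    coeff (fallingFactorial (2 + m)) 0 ≈⟨ coeff-*linear-zero (fallingFactorial (suc m)) _ 1# ⟩
    coeff (fallingFactorial (suc m)) 0 *ᴷ _ ≈⟨ *-congʳ (coeff-fallingFactorial-zero (suc m) (s≤s z≤n)) ⟩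
    0# *ᴷ _                                 ≈⟨ zeroˡ _ ⟩
    0#                                      ∎

  coeff-fallingFactorial-> : ∀ m k → m < k → coeff (fallingFactorial m) k ≈ 0#
  coeff-fallingFactorial-> zero    (suc k) _         = ≈-refl
  coeff-fallingFactorial-> (suc m) (suc k) (s≤s m<k) = begin
    coeff (fallingFactorial (suc m)) (suc k) ≈⟨ coeff-*linear-suc (fallingFactorial m) _ 1# k ⟩
    coeff (fallingFactorial m) (suc k) *ᴷ _ +ᴷ coeff (fallingFactorial m) k *ᴷ 1#
      ≈⟨ +-cong (*-congʳ (coeff-fallingFactorial-> m (suc k) (ℕₚ.m<n⇒m<1+n m<k)))
                (*-congʳ (coeff-fallingFactorial-> m k m<k)) ⟩
    0# *ᴷ _ +ᴷ 0# *ᴷ 1#                      ≈⟨ +-cong (zeroˡ _) (zeroˡ 1#) ⟩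
    0# +ᴷ 0#                                 ≈⟨ +-identityˡ 0# ⟩
    0#                                       ∎

  coeff-binomial-zero : ∀ m k → coeff (fallingFactorial m) k ≈ 0# → coeff (binomial m) k ≈ 0#
  coeff-binomial-zero m k ff≈0 =
    ≈-trans (coeff-constant* _ (fallingFactorial m) k) (≈-trans (*-congˡ ff≈0) (zeroʳ _))

  max≤length : (u : PackedWord n) → max u ≤ n
  max≤length u = maxLetter≤ (word u) λ i∈ → proj₂ (packed-letter-≤length u i∈)

  1≤max : .{{NonZero n}} → (u : PackedWord n) → 1 ≤ max u
  1≤max {n = suc n} u =
    let 1≤u₀ , u₀≤max = to (max-∈ u) (VecMembershipₚ.∈-lookup zero (word u)) in ℕₚ.≤-trans 1≤u₀ u₀≤max

  -- The binomials occurring in `σᵗ n` have no constant term, as max u ≥ 1 for n ≥ 1, and degree at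
  -- most max u ≤ n.
  E-zero : .{{NonZero n}} → ∀ k → k ≡ 0 ⊎ n < k → ∀ v → E n k v ≈ 0#
  E-zero {n} k k∉ v = ≈-trans
    (coeff-∑ (packedWords n) _ (λ u → coeff (binomial (max u)) k W.• W.N u) v k
      λ u → coeff-*N (binomial (max u)) u v k)
    (∑-zero (packedWords n) _ v λ u →
      ≈-trans (*-congʳ (coeff-binomial-zero (max u) k (vanishing u k∉))) (zeroˡ _))
    where
    vanishing : (u : PackedWord n) → k ≡ 0 ⊎ n < k → coeff (fallingFactorial (max u)) k ≈ 0#
    vanishing u (inj₁ refl) = coeff-fallingFactorial-zero (max u) (1≤max u)
    vanishing u (inj₂ n<k)  = coeff-fallingFactorial-> (max u) k (ℕₚ.≤-<-trans (max≤length u) n<k)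

  -- Compared at t^j, the left side is `N u` times `E n j` for every j; the sum on the right yields
  -- the same for j in `range n`, and by `E-zero` the omitted exponents contribute nothing.
  Eulerian-expansion : .{{NonZero n}} → (u : PackedWord n) →
    Wᵗ.N u Wᵗ.∗ σᵗ n Wᵗ.≋ Wᵗ.∑ (range n) (λ k → Wᵗ.power t k Wᵗ.• extendScalars (W.N u W.∗ E n k))
  Eulerian-expansion {n} u w j = ≈-trans (coeff-N∗ u (σᵗ n) w j) (≈-sym (rhs (position j)))
    where
    f : ℕ → W.WQSym n
    f k = W.N u W.∗ E n k
    position : ∀ j → (j ≡ 0 ⊎ n < j) ⊎ (1 ≤ j × j ≤ n)
    position zero    = inj₁ (inj₁ refl)
    position (suc j) with suc j ℕₚ.≤? n
    ... | yes j≤n = inj₂ (s≤s z≤n , j≤n)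
    ... | no  j≰n = inj₁ (inj₂ (ℕₚ.≰⇒> j≰n))
    j∉range : j ≡ 0 ⊎ n < j → ¬ j L.∈ range n
    j∉range (inj₁ refl) j∈ with () ← proj₁ (∈-range⁻ j∈)
    j∉range (inj₂ n<j)  j∈ = ℕₚ.<⇒≱ n<j (proj₂ (∈-range⁻ j∈))
    rhs : (j ≡ 0 ⊎ n < j) ⊎ (1 ≤ j × j ≤ n) →
      coeff (Wᵗ.∑ (range n) (λ k → Wᵗ.power t k Wᵗ.• extendScalars (f k)) w) j ≈ f j w
    rhs (inj₁ j∉) = ≈-trans (coeff-∑-term-∉ f w j (range n) (j∉range j∉))
      (≈-sym (∗-zeroʳ (W.N u) (E n j) (E-zero j j∉) w))
    rhs (inj₂ (1≤j , j≤n)) = coeff-∑-term-∈ f w j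
      (Uniqueₚ.map⁺ ℕₚ.suc-injective (Uniqueₚ.upTo⁺ n)) (∈-range⁺ 1≤j j≤n)

mainTheorem4 :
    ∀ {c ℓ₁ ℓ₂} (K : HeytingField c ℓ₁ ℓ₂) (char0 : CharacteristicZero K) →
    let open Eulerian K char0
        open Over-K[t]
    in
    (n : ℕ) (u : PackedWord n) →
    let V : WQSym n
        V = N u ∗ σᵗ n
    in
    (NonZero n → V ≋ ∑ (range n) (λ k → power t k • extendScalars (Over-K._∗_ (Over-K.N u) (E n k))))
    ×
    (V ≋ ∑ (finerWords u) (λ w → product (range (max u)) (λ i → binomial (max (block u w i))) • N w))
mainTheorem4 K char0 n u =
  (λ n≢0 → EulerianProperties.Eulerian-expansion K char0 {{n≢0}} u) ,
  EulerianProperties.finer-expansion K char0 u
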